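{- There is an effective procedure which assigns to each $\Sigma_1$-sentence $\sigma$ of $\mathbb{L}_{\sf a}$ an $\mathbb{L}_{\sf ap}$-sentence $[\sigma]_{\sf p}$ such that: (1) $[\sigma]_{\sf p} \vdash \sigma$; (2) if $\mathbb{N}\models\sigma$, then $\mathsf{R}_{0\mathsf{p}} \vdash [\sigma]_{\sf p}$; (3) if $\mathbb{N}\models\neg\sigma$, then $[\sigma]_{\sf p} \vdash \mathsf{R}_{0\mathsf{p}}$.
   Context: $\mathbb{L}_{\sf a}$ is the signature $\{0,\mathsf{S},+,\times,\leq\}$ with $\leq$ primitive; $\overline{n}$ is the $n$-th numeral. $\mathsf{R}_0$ is the $\mathbb{L}_{\sf a}$-theory with axioms, for all $m,n\in\omega$: $\overline{m}+\overline{n}=\overline{m+n}$; $\overline{m}\times\overline{n}=\overline{m\times n}$; $\overline{m}\neq\overline{n}$ if $m\neq n$; $\forall x\,(x\leq\overline{n}\to\bigvee_{i\leq n}x=\overline{i})$; $\overline{m}\leq\overline{n}$ if $m\leq n$. $\mathbb{L}_{\sf ap}$ is $\mathbb{L}_{\sf a}$ extended by a unary predicate symbol $\mathsf{P}$, and $\mathsf{R}_{0\mathsf{p}}$ is the $\mathbb{L}_{\sf ap}$-theory $\mathsf{R}_0$ plus the axioms $\mathsf{P}(\overline{n})$ for all $n\in\omega$. A $\Sigma_1$-sentence is one of the form $\exists\vec{x}\,\delta$ with $\delta$ bounded. -}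

module Defs where

open import Data.Nat using (ℕ; zero; suc; _+_; _*_; _≤_)
open import Data.Fin using (Fin; zero; suc)
open import Data.Product using (Σ; _×_; _,_)
open import Data.Sum using (_⊎_)
open import Data.Empty using (⊥)
open import Relation.Binary.PropositionalEquality using (_≡_; _≢_)

-- Languages: 𝕃a = {0, S, +, ×, ≤}  and  𝕃ap = 𝕃a ∪ {P}

data Lang : Set where
  La Lap : Lang

-- Terms with de Bruijn variables; n = number of free variables in scope.
-- Terms are the same for both languages (P is a predicate symbol).
data Term (n : ℕ) : Set where
  var  : Fin n → Term n
  zer  : Term n
  S    : Term n → Term n
  _⊕_  : Term n → Term n → Term n
  _⊗_  : Term n → Term n → Term n

data Formula : Lang → ℕ → Set where
  _≐_   : ∀ {L n} → Term n → Term n → Formula L n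
  _≼_   : ∀ {L n} → Term n → Term n → Formula L n
  P     : ∀ {n} → Term n → Formula Lap n
  ⊥'    : ∀ {L n} → Formula L n
  _⇒_   : ∀ {L n} → Formula L n → Formula L n → Formula L n
  _∧'_  : ∀ {L n} → Formula L n → Formula L n → Formula L n
  _∨'_  : ∀ {L n} → Formula L n → Formula L n → Formula L n
  ∀'    : ∀ {L n} → Formula L (suc n) → Formula L n
  ∃'    : ∀ {L n} → Formula L (suc n) → Formula L n

infix  7 _≐_ _≼_
infixr 6 _∧'_
infixr 5 _∨'_
infixr 4 _⇒_

¬' : ∀ {L n} → Formula L n → Formula L n
¬' φ = φ ⇒ ⊥'

Sentence : Lang → Set
Sentence L = Formula L 0

emb : ∀ {n} → Formula La n → Formula Lap n
emb (s ≐ t)   = s ≐ t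
emb (s ≼ t)   = s ≼ t
emb ⊥'        = ⊥'
emb (φ ⇒ ψ)   = emb φ ⇒ emb ψ
emb (φ ∧' ψ)  = emb φ ∧' emb ψ
emb (φ ∨' ψ)  = emb φ ∨' emb ψ
emb (∀' φ)    = ∀' (emb φ)
emb (∃' φ)    = ∃' (emb φ)

liftR : ∀ {n m} → (Fin n → Fin m) → Fin (suc n) → Fin (suc m)
liftR ρ zero    = zero
liftR ρ (suc i) = suc (ρ i)

renT : ∀ {n m} → (Fin n → Fin m) → Term n → Term m
renT ρ (var i) = var (ρ i)
renT ρ zer     = zer
renT ρ (S t)   = S (renT ρ t)
renT ρ (s ⊕ t) = renT ρ s ⊕ renT ρ t
renT ρ (s ⊗ t) = renT ρ s ⊗ renT ρ t

ren : ∀ {L n m} → (Fin n → Fin m) → Formula L n → Formula L m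
ren ρ (s ≐ t)  = renT ρ s ≐ renT ρ t
ren ρ (s ≼ t)  = renT ρ s ≼ renT ρ t
ren ρ (P t)    = P (renT ρ t)
ren ρ ⊥'       = ⊥'
ren ρ (φ ⇒ ψ)  = ren ρ φ ⇒ ren ρ ψ
ren ρ (φ ∧' ψ) = ren ρ φ ∧' ren ρ ψ
ren ρ (φ ∨' ψ) = ren ρ φ ∨' ren ρ ψ
ren ρ (∀' φ)   = ∀' (ren (liftR ρ) φ)
ren ρ (∃' φ)   = ∃' (ren (liftR ρ) φ)

wkT : ∀ {n} → Term n → Term (suc n)
wkT = renT suc

wk : ∀ {L n} → Formula L n → Formula L (suc n)
wk = ren suc

closedWk : ∀ {L n} → Sentence L → Formula L n
closedWk = ren (λ ())

liftS : ∀ {n m} → (Fin n → Term m) → Fin (suc n) → Term (suc m)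
liftS σ zero    = var zero
liftS σ (suc i) = wkT (σ i)

subT : ∀ {n m} → (Fin n → Term m) → Term n → Term m
subT σ (var i) = σ i
subT σ zer     = zer
subT σ (S t)   = S (subT σ t)
subT σ (s ⊕ t) = subT σ s ⊕ subT σ t
subT σ (s ⊗ t) = subT σ s ⊗ subT σ t

sub : ∀ {L n m} → (Fin n → Term m) → Formula L n → Formula L m
sub σ (s ≐ t)  = subT σ s ≐ subT σ t
sub σ (s ≼ t)  = subT σ s ≼ subT σ t
sub σ (P t)    = P (subT σ t)
sub σ ⊥'       = ⊥'
sub σ (φ ⇒ ψ)  = sub σ φ ⇒ sub σ ψ
sub σ (φ ∧' ψ) = sub σ φ ∧' sub σ ψ
sub σ (φ ∨' ψ) = sub σ φ ∨' sub σ ψ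
sub σ (∀' φ)   = ∀' (sub (liftS σ) φ)
sub σ (∃' φ)   = ∃' (sub (liftS σ) φ)

single : ∀ {n} → Term n → Fin (suc n) → Term n
single t zero    = t
single t (suc i) = var i

_[_] : ∀ {L n} → Formula L (suc n) → Term n → Formula L n
φ [ t ] = sub (single t) φ

num : ∀ {n} → ℕ → Term n
num zero    = zer
num (suc k) = S (num k)

data Bounded : ∀ {n} → Formula La n → Set where
  b≐  : ∀ {n} (s t : Term n) → Bounded (s ≐ t)
  b≼  : ∀ {n} (s t : Term n) → Bounded (s ≼ t)
  b⊥  : ∀ {n} → Bounded {n} ⊥'
  b⇒  : ∀ {n} {φ ψ : Formula La n} → Bounded φ → Bounded ψ → Bounded (φ ⇒ ψ)
  b∧  : ∀ {n} {φ ψ : Formula La n} → Bounded φ → Bounded ψ → Bounded (φ ∧' ψ)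
  b∨  : ∀ {n} {φ ψ : Formula La n} → Bounded φ → Bounded ψ → Bounded (φ ∨' ψ)
  b∀≤ : ∀ {n} (t : Term n) {φ : Formula La (suc n)} → Bounded φ →
        Bounded (∀' (var zero ≼ wkT t ⇒ φ))
  b∃≤ : ∀ {n} (t : Term n) {φ : Formula La (suc n)} → Bounded φ →
        Bounded (∃' (var zero ≼ wkT t ∧' φ))

data IsΣ₁ : ∀ {n} → Formula La n → Set where
  bnd : ∀ {n} {δ : Formula La n} → Bounded δ → IsΣ₁ δ
  ex  : ∀ {n} {φ : Formula La (suc n)} → IsΣ₁ φ → IsΣ₁ (∃' φ)

Σ₁Sentence : Set
Σ₁Sentence = Σ (Sentence La) IsΣ₁

extend : ∀ {n} → ℕ → (Fin n → ℕ) → Fin (suc n) → ℕ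
extend a e zero    = a
extend a e (suc i) = e i

evalT : ∀ {n} → (Fin n → ℕ) → Term n → ℕ
evalT e (var i) = e i
evalT e zer     = zero
evalT e (S t)   = suc (evalT e t)
evalT e (s ⊕ t) = evalT e s + evalT e t
evalT e (s ⊗ t) = evalT e s * evalT e t

Sat : ∀ {n} → (Fin n → ℕ) → Formula La n → Set
Sat e (s ≐ t)  = evalT e s ≡ evalT e t
Sat e (s ≼ t)  = evalT e s ≤ evalT e t
Sat e ⊥'       = ⊥
Sat e (φ ⇒ ψ)  = Sat e φ → Sat e ψ
Sat e (φ ∧' ψ) = Sat e φ × Sat e ψ
Sat e (φ ∨' ψ) = Sat e φ ⊎ Sat e ψ
Sat e (∀' φ)   = (a : ℕ) → Sat (extend a e) φ
Sat e (∃' φ)   = Σ ℕ (λ a → Sat (extend a e) φ)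

ℕ⊨_ : Sentence La → Set
ℕ⊨ σ = Sat (λ ()) σ

Theory : Set₁
Theory = Sentence Lap → Set

data _⊢_ (T : Theory) : ∀ {n} → Formula Lap n → Set where
  hyp   : ∀ {n} {σ : Sentence Lap} → T σ → T ⊢ closedWk {n = n} σ
  ax-K  : ∀ {n} {φ ψ : Formula Lap n} → T ⊢ (φ ⇒ ψ ⇒ φ)
  ax-S  : ∀ {n} {φ ψ χ : Formula Lap n} →
          T ⊢ ((φ ⇒ ψ ⇒ χ) ⇒ (φ ⇒ ψ) ⇒ φ ⇒ χ)
  ax-DN : ∀ {n} {φ : Formula Lap n} → T ⊢ (¬' (¬' φ) ⇒ φ)
  ax-∧₁ : ∀ {n} {φ ψ : Formula Lap n} → T ⊢ (φ ∧' ψ ⇒ φ)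
  ax-∧₂ : ∀ {n} {φ ψ : Formula Lap n} → T ⊢ (φ ∧' ψ ⇒ ψ)
  ax-∧I : ∀ {n} {φ ψ : Formula Lap n} → T ⊢ (φ ⇒ ψ ⇒ φ ∧' ψ)
  ax-∨₁ : ∀ {n} {φ ψ : Formula Lap n} → T ⊢ (φ ⇒ φ ∨' ψ)
  ax-∨₂ : ∀ {n} {φ ψ : Formula Lap n} → T ⊢ (ψ ⇒ φ ∨' ψ)
  ax-∨E : ∀ {n} {φ ψ χ : Formula Lap n} →
          T ⊢ ((φ ⇒ χ) ⇒ (ψ ⇒ χ) ⇒ φ ∨' ψ ⇒ χ)
  ax-∀E : ∀ {n} {φ : Formula Lap (suc n)} (t : Term n) → T ⊢ (∀' φ ⇒ φ [ t ])
  ax-∃I : ∀ {n} {φ : Formula Lap (suc n)} (t : Term n) → T ⊢ (φ [ t ] ⇒ ∃' φ)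
  ax-≐R : ∀ {n} (t : Term n) → T ⊢ (t ≐ t)
  ax-≐L : ∀ {n} {φ : Formula Lap (suc n)} (s t : Term n) →
          T ⊢ (s ≐ t ⇒ φ [ s ] ⇒ φ [ t ])
  mp    : ∀ {n} {φ ψ : Formula Lap n} → T ⊢ (φ ⇒ ψ) → T ⊢ φ → T ⊢ ψ
  ∀-R   : ∀ {n} {ψ : Formula Lap n} {φ : Formula Lap (suc n)} →
          T ⊢ (wk ψ ⇒ φ) → T ⊢ (ψ ⇒ ∀' φ)
  ∃-R   : ∀ {n} {ψ : Formula Lap n} {φ : Formula Lap (suc n)} →
          T ⊢ (φ ⇒ wk ψ) → T ⊢ (∃' φ ⇒ ψ)

⟨_⟩ : Sentence Lap → Theory
⟨ τ ⟩ σ = σ ≡ τ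

_⊢all_ : Theory → Theory → Set
T ⊢all U = ∀ σ → U σ → T ⊢ σ

bigOr : ∀ {n} → ℕ → Formula Lap (suc n)
bigOr zero    = var zero ≐ num zero
bigOr (suc k) = bigOr k ∨' (var zero ≐ num (suc k))

data R₀ : Theory where
  r-add : ∀ m n → R₀ (num m ⊕ num n ≐ num (m + n))
  r-mul : ∀ m n → R₀ (num m ⊗ num n ≐ num (m * n))
  r-neq : ∀ m n → m ≢ n → R₀ (¬' (num m ≐ num n))
  r-bnd : ∀ n → R₀ (∀' (var zero ≼ num n ⇒ bigOr n))
  r-leq : ∀ m n → m ≤ n → R₀ (num m ≼ num n)

data R₀p : Theory where
  r₀  : ∀ {σ} → R₀ σ → R₀p σ
  r-P : ∀ n → R₀p (P (num n))

-- [σ]ₚ is σ ∧ ∃x (Loc(x) ∧ ∀y≤x P(y) ∧ W(x)). Loc(x) is a finite conjunction of bounded facts about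
-- the numbers up to x (the recursion equations of + and ×, discreteness of ≤, and that sums and
-- products cannot jump over x), true in ℕ for every x; W(x) says that σ has witnesses ≤ x and that no
-- number met while evaluating its matrix at them exceeds x.
--
-- If σ is true, let x be the largest number met while evaluating σ at some witnesses. R₀ decides every
-- bounded sentence, so R₀p proves Loc(x̄) and W(x̄), and ∀y≤x̄ P(y) by the bound axiom of R₀.
--
-- If σ is false, reason under the matrix. By induction on j, every numeral j̄ lies below x: Loc(x)
-- gives j̄ = x ∨ S j̄ ≤ x, and x = j̄ is impossible, since then Loc(x) proves the R₀-facts about the
-- numbers up to j and refutes every overflow beyond j, which suffices to refute W(j̄). With all
-- numerals below x, Loc(x) yields every axiom of R₀, and ∀y≤x P(y) every P(n̄).

module Submission where

open import Defs
open import Data.Empty using (⊥-elim)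
open import Data.Fin using (Fin; zero; suc; #_)
open import Data.Nat using (ℕ; zero; suc; _+_; _*_; _∸_; _≤_; _<_; z≤n; _⊔_; _≟_; _≤?_)
open import Data.Nat.Properties
  using (≤-refl; ≤-trans; <⇒≤; ≤-<-trans; ≰⇒>; <-irrefl; n≮0; n≤1+n; n≤0⇒n≡0; m≤n⇒m≤1+n; m≤n⇒m<n∨m≡n;
         m<1+n⇒m≤n; m≤m⊔n; m≤n⊔m; ⊔-lub; m⊔n≤o⇒m≤o; m⊔n≤o⇒n≤o; m≤m+n; m≤n+m; m∸n≤m; m+[n∸m]≡n;
         +-identityʳ; +-suc; +-comm; +-cancelˡ-<; *-zeroʳ; *-suc; *-monoʳ-≤; suc-injective)
open import Data.Product using (Σ; _×_; _,_; proj₁; proj₂)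
open import Data.Sum using (_⊎_; inj₁; inj₂)
import Data.Sum as Sum
open import Data.Vec using (Vec; []; _∷_; lookup)
open import Data.Vec.Relation.Unary.All using (All; []; _∷_)
open import Function using (_∘_)
open import Relation.Binary.PropositionalEquality
  using (_≡_; _≢_; _≗_; refl; sym; trans; cong; cong₂; subst; subst₂)
open import Relation.Nullary using (¬_; Dec; yes; no; ¬?; _→-dec_; _×-dec_; _⊎-dec_)

liftS-cong : ∀ {n m} {σ σ′ : Fin n → Term m} → σ ≗ σ′ → liftS σ ≗ liftS σ′
liftS-cong h zero    = refl
liftS-cong h (suc i) = cong wkT (h i)

subT-cong : ∀ {n m} {σ σ′ : Fin n → Term m} → σ ≗ σ′ → (t : Term n) → subT σ t ≡ subT σ′ t
subT-cong h (var i) = h i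
subT-cong h zer     = refl
subT-cong h (S t)   = cong S (subT-cong h t)
subT-cong h (s ⊕ t) = cong₂ _⊕_ (subT-cong h s) (subT-cong h t)
subT-cong h (s ⊗ t) = cong₂ _⊗_ (subT-cong h s) (subT-cong h t)

sub-cong : ∀ {L n m} {σ σ′ : Fin n → Term m} → σ ≗ σ′ → (φ : Formula L n) → sub σ φ ≡ sub σ′ φ
sub-cong h (s ≐ t)  = cong₂ _≐_ (subT-cong h s) (subT-cong h t)
sub-cong h (s ≼ t)  = cong₂ _≼_ (subT-cong h s) (subT-cong h t)
sub-cong h (P t)    = cong P (subT-cong h t)
sub-cong h ⊥'       = refl
sub-cong h (φ ⇒ ψ)  = cong₂ _⇒_ (sub-cong h φ) (sub-cong h ψ)
sub-cong h (φ ∧' ψ) = cong₂ _∧'_ (sub-cong h φ) (sub-cong h ψ)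
sub-cong h (φ ∨' ψ) = cong₂ _∨'_ (sub-cong h φ) (sub-cong h ψ)
sub-cong h (∀' φ)   = cong ∀' (sub-cong (liftS-cong h) φ)
sub-cong h (∃' φ)   = cong ∃' (sub-cong (liftS-cong h) φ)

subT-id : ∀ {n} (t : Term n) → subT var t ≡ t
subT-id (var i) = refl
subT-id zer     = refl
subT-id (S t)   = cong S (subT-id t)
subT-id (s ⊕ t) = cong₂ _⊕_ (subT-id s) (subT-id t)
subT-id (s ⊗ t) = cong₂ _⊗_ (subT-id s) (subT-id t)

liftS-var : ∀ {n} → liftS {n} var ≗ var
liftS-var zero    = refl
liftS-var (suc i) = refl

sub-id : ∀ {L n} (φ : Formula L n) → sub var φ ≡ φ
sub-id (s ≐ t)  = cong₂ _≐_ (subT-id s) (subT-id t)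
sub-id (s ≼ t)  = cong₂ _≼_ (subT-id s) (subT-id t)
sub-id (P t)    = cong P (subT-id t)
sub-id ⊥'       = refl
sub-id (φ ⇒ ψ)  = cong₂ _⇒_ (sub-id φ) (sub-id ψ)
sub-id (φ ∧' ψ) = cong₂ _∧'_ (sub-id φ) (sub-id ψ)
sub-id (φ ∨' ψ) = cong₂ _∨'_ (sub-id φ) (sub-id ψ)
sub-id (∀' φ)   = cong ∀' (trans (sub-cong liftS-var φ) (sub-id φ))
sub-id (∃' φ)   = cong ∃' (trans (sub-cong liftS-var φ) (sub-id φ))

renT-as-subT : ∀ {n m} (ρ : Fin n → Fin m) (t : Term n) → renT ρ t ≡ subT (var ∘ ρ) t
renT-as-subT ρ (var i) = refl
renT-as-subT ρ zer     = refl
renT-as-subT ρ (S t)   = cong S (renT-as-subT ρ t)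
renT-as-subT ρ (s ⊕ t) = cong₂ _⊕_ (renT-as-subT ρ s) (renT-as-subT ρ t)
renT-as-subT ρ (s ⊗ t) = cong₂ _⊗_ (renT-as-subT ρ s) (renT-as-subT ρ t)

liftR-as-liftS : ∀ {n m} (ρ : Fin n → Fin m) → var ∘ liftR ρ ≗ liftS (var ∘ ρ)
liftR-as-liftS ρ zero    = refl
liftR-as-liftS ρ (suc i) = refl

ren-as-sub : ∀ {L n m} (ρ : Fin n → Fin m) (φ : Formula L n) → ren ρ φ ≡ sub (var ∘ ρ) φ
ren-as-sub ρ (s ≐ t)  = cong₂ _≐_ (renT-as-subT ρ s) (renT-as-subT ρ t)
ren-as-sub ρ (s ≼ t)  = cong₂ _≼_ (renT-as-subT ρ s) (renT-as-subT ρ t)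
ren-as-sub ρ (P t)    = cong P (renT-as-subT ρ t)
ren-as-sub ρ ⊥'       = refl
ren-as-sub ρ (φ ⇒ ψ)  = cong₂ _⇒_ (ren-as-sub ρ φ) (ren-as-sub ρ ψ)
ren-as-sub ρ (φ ∧' ψ) = cong₂ _∧'_ (ren-as-sub ρ φ) (ren-as-sub ρ ψ)
ren-as-sub ρ (φ ∨' ψ) = cong₂ _∨'_ (ren-as-sub ρ φ) (ren-as-sub ρ ψ)
ren-as-sub ρ (∀' φ)   = cong ∀' (trans (ren-as-sub (liftR ρ) φ) (sub-cong (liftR-as-liftS ρ) φ))
ren-as-sub ρ (∃' φ)   = cong ∃' (trans (ren-as-sub (liftR ρ) φ) (sub-cong (liftR-as-liftS ρ) φ))

subT-subT : ∀ {n m k} (σ : Fin m → Term k) (τ : Fin n → Term m) (t : Term n) →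
            subT σ (subT τ t) ≡ subT (subT σ ∘ τ) t
subT-subT σ τ (var i) = refl
subT-subT σ τ zer     = refl
subT-subT σ τ (S t)   = cong S (subT-subT σ τ t)
subT-subT σ τ (s ⊕ t) = cong₂ _⊕_ (subT-subT σ τ s) (subT-subT σ τ t)
subT-subT σ τ (s ⊗ t) = cong₂ _⊗_ (subT-subT σ τ s) (subT-subT σ τ t)

subT-renT : ∀ {n m k} (σ : Fin m → Term k) (ρ : Fin n → Fin m) (t : Term n) →
            subT σ (renT ρ t) ≡ subT (σ ∘ ρ) t
subT-renT σ ρ t = trans (cong (subT σ) (renT-as-subT ρ t)) (subT-subT σ (var ∘ ρ) t)

renT-subT : ∀ {n m k} (ρ : Fin m → Fin k) (σ : Fin n → Term m) (t : Term n) →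
            renT ρ (subT σ t) ≡ subT (renT ρ ∘ σ) t
renT-subT ρ σ t = trans (renT-as-subT ρ (subT σ t))
  (trans (subT-subT (var ∘ ρ) σ t) (subT-cong (λ i → sym (renT-as-subT ρ (σ i))) t))

liftS-subT : ∀ {n m k} (σ : Fin m → Term k) (τ : Fin n → Term m) →
             subT (liftS σ) ∘ liftS τ ≗ liftS (subT σ ∘ τ)
liftS-subT σ τ zero    = refl
liftS-subT σ τ (suc i) = trans (subT-renT (liftS σ) suc (τ i)) (sym (renT-subT suc σ (τ i)))

sub-sub : ∀ {L n m k} (σ : Fin m → Term k) (τ : Fin n → Term m) (φ : Formula L n) →
          sub σ (sub τ φ) ≡ sub (subT σ ∘ τ) φ
sub-sub σ τ (s ≐ t)  = cong₂ _≐_ (subT-subT σ τ s) (subT-subT σ τ t)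
sub-sub σ τ (s ≼ t)  = cong₂ _≼_ (subT-subT σ τ s) (subT-subT σ τ t)
sub-sub σ τ (P t)    = cong P (subT-subT σ τ t)
sub-sub σ τ ⊥'       = refl
sub-sub σ τ (φ ⇒ ψ)  = cong₂ _⇒_ (sub-sub σ τ φ) (sub-sub σ τ ψ)
sub-sub σ τ (φ ∧' ψ) = cong₂ _∧'_ (sub-sub σ τ φ) (sub-sub σ τ ψ)
sub-sub σ τ (φ ∨' ψ) = cong₂ _∨'_ (sub-sub σ τ φ) (sub-sub σ τ ψ)
sub-sub σ τ (∀' φ)   = cong ∀' (trans (sub-sub (liftS σ) (liftS τ) φ) (sub-cong (liftS-subT σ τ) φ))
sub-sub σ τ (∃' φ)   = cong ∃' (trans (sub-sub (liftS σ) (liftS τ) φ) (sub-cong (liftS-subT σ τ) φ))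

sub-ren : ∀ {L n m k} (σ : Fin m → Term k) (ρ : Fin n → Fin m) (φ : Formula L n) →
          sub σ (ren ρ φ) ≡ sub (σ ∘ ρ) φ
sub-ren σ ρ φ = trans (cong (sub σ) (ren-as-sub ρ φ)) (sub-sub σ (var ∘ ρ) φ)

ren-sub : ∀ {L n m k} (ρ : Fin m → Fin k) (σ : Fin n → Term m) (φ : Formula L n) →
          ren ρ (sub σ φ) ≡ sub (renT ρ ∘ σ) φ
ren-sub ρ σ φ = trans (ren-as-sub ρ (sub σ φ))
  (trans (sub-sub (var ∘ ρ) σ φ) (sub-cong (λ i → sym (renT-as-subT ρ (σ i))) φ))

ren-ren : ∀ {L n m k} (ρ : Fin m → Fin k) (ρ′ : Fin n → Fin m) (φ : Formula L n) →
          ren ρ (ren ρ′ φ) ≡ ren (ρ ∘ ρ′) φ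
ren-ren ρ ρ′ φ = trans (cong (ren ρ) (ren-as-sub ρ′ φ)) (trans (ren-sub ρ (var ∘ ρ′) φ) (sym (ren-as-sub (ρ ∘ ρ′) φ)))

subT-num : ∀ {n m} (σ : Fin n → Term m) k → subT σ (num k) ≡ num k
subT-num σ zero    = refl
subT-num σ (suc k) = cong S (subT-num σ k)

renT-num : ∀ {n m} (ρ : Fin n → Fin m) k → renT ρ (num k) ≡ num k
renT-num ρ k = trans (renT-as-subT ρ (num k)) (subT-num (var ∘ ρ) k)

wkT-[] : ∀ {n} (u t : Term n) → subT (single u) (wkT t) ≡ t
wkT-[] u t = trans (subT-renT (single u) suc t) (subT-id t)

_▸_ : ∀ {n m} → Term m → (Fin n → Term m) → Fin (suc n) → Term m
(u ▸ τ) zero    = u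
(u ▸ τ) (suc i) = τ i

liftS-[] : ∀ {L n m} (τ : Fin n → Term m) (χ : Formula L (suc n)) (u : Term m) → sub (liftS τ) χ [ u ] ≡ sub (u ▸ τ) χ
liftS-[] τ χ u = trans (sub-sub _ _ χ) (sub-cong pointwise χ)
  where
  pointwise : subT (single u) ∘ liftS τ ≗ u ▸ τ
  pointwise zero    = refl
  pointwise (suc i) = wkT-[] u (τ i)

liftS-wkT-[] : ∀ {n m} (τ : Fin n → Term m) (t : Term n) (u : Term m) → subT (single u) (subT (liftS τ) (wkT t)) ≡ subT τ t
liftS-wkT-[] τ t u = trans (subT-subT _ _ (wkT t)) (trans (subT-renT _ suc t) (subT-cong (λ i → wkT-[] u (τ i)) t))

closedWk-zero : ∀ {L} (σ : Sentence L) → closedWk {n = 0} σ ≡ σ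
closedWk-zero σ = trans (ren-as-sub (λ ()) σ) (trans (sub-cong (λ ()) σ) (sub-id σ))

ren-closedWk : ∀ {L n m} (ρ : Fin n → Fin m) (σ : Sentence L) → ren ρ (closedWk {n = n} σ) ≡ closedWk σ
ren-closedWk ρ σ = trans (ren-ren ρ (λ ()) σ) (trans (ren-as-sub _ σ) (trans (sub-cong (λ ()) σ) (sym (ren-as-sub _ σ))))

ren-wk : ∀ {L n m} (ρ : Fin n → Fin m) (φ : Formula L n) → ren (liftR ρ) (wk φ) ≡ wk (ren ρ φ)
ren-wk ρ φ = trans (ren-ren (liftR ρ) suc φ) (sym (ren-ren suc ρ φ))

ren-[] : ∀ {L n m} (ρ : Fin n → Fin m) (φ : Formula L (suc n)) (t : Term n) →
         ren ρ (φ [ t ]) ≡ ren (liftR ρ) φ [ renT ρ t ]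
ren-[] ρ φ t = trans (ren-sub ρ (single t) φ) (trans (sub-cong commute φ) (sym (sub-ren (single (renT ρ t)) (liftR ρ) φ)))
  where
  commute : renT ρ ∘ single t ≗ single (renT ρ t) ∘ liftR ρ
  commute zero    = refl
  commute (suc i) = refl

ren-bigOr : ∀ {n m} (ρ : Fin n → Fin m) c → ren (liftR ρ) (bigOr c) ≡ bigOr c
ren-bigOr ρ zero    = refl
ren-bigOr ρ (suc c) = cong₂ _∨'_ (ren-bigOr ρ c) (cong (var zero ≐_) (renT-num (liftR ρ) (suc c)))

bigOr-[var] : ∀ {n} c → bigOr {n = suc n} c [ var zero ] ≡ bigOr c
bigOr-[var] zero    = refl
bigOr-[var] (suc c) = cong₂ _∨'_ (bigOr-[var] c) (cong (var zero ≐_) (subT-num _ (suc c)))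

ren-bound-axiom : ∀ {n m} (ρ : Fin n → Fin m) c →
                  ren ρ (∀' (var zero ≼ num c ⇒ bigOr c)) ≡ ∀' (var zero ≼ num c ⇒ bigOr c)
ren-bound-axiom ρ c = cong ∀' (cong₂ _⇒_ (cong (var zero ≼_) (renT-num _ c)) (ren-bigOr ρ c))

instT : ∀ {n m} → (Fin n → ℕ) → Term n → Term m
instT e = subT (num ∘ e)

inst : ∀ {n m} → (Fin n → ℕ) → Formula La n → Formula Lap m
inst e φ = sub (num ∘ e) (emb φ)

-- inst e (∀' ψ) reduces to ∀' (instᵇ e ψ)
instᵇ : ∀ {n m} → (Fin n → ℕ) → Formula La (suc n) → Formula Lap (suc m)
instᵇ e ψ = sub (liftS (num ∘ e)) (emb ψ)

instᵇ-[num] : ∀ {n m} (e : Fin n → ℕ) (ψ : Formula La (suc n)) a → instᵇ {m = m} e ψ [ num a ] ≡ inst (extend a e) ψ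
instᵇ-[num] e ψ a = trans (liftS-[] (num ∘ e) (emb ψ) (num a)) (sub-cong (λ { zero → refl ; (suc i) → refl }) (emb ψ))

instᵇ-[var] : ∀ {n m} (e : Fin n → ℕ) (ψ : Formula La (suc n)) → instᵇ {m = suc m} e ψ [ var zero ] ≡ instᵇ e ψ
instᵇ-[var] e ψ = trans (liftS-[] (num ∘ e) (emb ψ) (var zero))
  (sub-cong (λ { zero → refl ; (suc i) → sym (renT-num suc (e i)) }) (emb ψ))

instᵇT : ∀ {n m} → (Fin n → ℕ) → Term n → Term (suc m)
instᵇT e t = subT (liftS (num ∘ e)) (wkT t)

instᵇT≡instT : ∀ {n m} (e : Fin n → ℕ) (t : Term n) → instᵇT {m = m} e t ≡ instT e t
instᵇT≡instT e t = trans (subT-renT _ suc t) (subT-cong (λ i → renT-num suc (e i)) t)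

emb-ren : ∀ {n m} (ρ : Fin n → Fin m) (φ : Formula La n) → emb (ren ρ φ) ≡ ren ρ (emb φ)
emb-ren ρ (s ≐ t)  = refl
emb-ren ρ (s ≼ t)  = refl
emb-ren ρ ⊥'       = refl
emb-ren ρ (φ ⇒ ψ)  = cong₂ _⇒_ (emb-ren ρ φ) (emb-ren ρ ψ)
emb-ren ρ (φ ∧' ψ) = cong₂ _∧'_ (emb-ren ρ φ) (emb-ren ρ ψ)
emb-ren ρ (φ ∨' ψ) = cong₂ _∨'_ (emb-ren ρ φ) (emb-ren ρ ψ)
emb-ren ρ (∀' φ)   = cong ∀' (emb-ren (liftR ρ) φ)
emb-ren ρ (∃' φ)   = cong ∃' (emb-ren (liftR ρ) φ)

inst-ren : ∀ {n k m} (e : Fin k → ℕ) (ρ : Fin n → Fin k) (φ : Formula La n) → inst {m = m} e (ren ρ φ) ≡ inst (e ∘ ρ) φ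
inst-ren e ρ φ = trans (cong (sub (num ∘ e)) (emb-ren ρ φ)) (sub-ren (num ∘ e) ρ (emb φ))

inst-closed : ∀ {m} (σ : Sentence La) → inst {m = m} (λ ()) σ ≡ closedWk (emb σ)
inst-closed σ = trans (sub-cong (λ ()) (emb σ)) (sym (ren-as-sub (λ ()) (emb σ)))

module Derivations (T : Theory) where

  infix 3 _⊩_
  _⊩_ : ∀ {n} → Formula Lap n → Formula Lap n → Set
  Γ ⊩ φ = T ⊢ (Γ ⇒ φ)

  ren-⊢ : ∀ {n m} (ρ : Fin n → Fin m) {φ : Formula Lap n} → T ⊢ φ → T ⊢ ren ρ φ
  ren-⊢ ρ (hyp {σ = σ} x) = subst (T ⊢_) (sym (ren-closedWk ρ σ)) (hyp x)
  ren-⊢ ρ ax-K  = ax-K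
  ren-⊢ ρ ax-S  = ax-S
  ren-⊢ ρ ax-DN = ax-DN
  ren-⊢ ρ ax-∧₁ = ax-∧₁
  ren-⊢ ρ ax-∧₂ = ax-∧₂
  ren-⊢ ρ ax-∧I = ax-∧I
  ren-⊢ ρ ax-∨₁ = ax-∨₁
  ren-⊢ ρ ax-∨₂ = ax-∨₂
  ren-⊢ ρ ax-∨E = ax-∨E
  ren-⊢ ρ (ax-∀E {φ = φ} t) =
    subst (λ x → T ⊢ (∀' (ren (liftR ρ) φ) ⇒ x)) (sym (ren-[] ρ φ t)) (ax-∀E (renT ρ t))
  ren-⊢ ρ (ax-∃I {φ = φ} t) =
    subst (λ x → T ⊢ (x ⇒ ∃' (ren (liftR ρ) φ))) (sym (ren-[] ρ φ t)) (ax-∃I (renT ρ t))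
  ren-⊢ ρ (ax-≐R t) = ax-≐R (renT ρ t)
  ren-⊢ ρ (ax-≐L {φ = φ} s t) =
    subst₂ (λ x y → T ⊢ (renT ρ s ≐ renT ρ t ⇒ x ⇒ y)) (sym (ren-[] ρ φ s)) (sym (ren-[] ρ φ t))
      (ax-≐L {φ = ren (liftR ρ) φ} (renT ρ s) (renT ρ t))
  ren-⊢ ρ (mp d e) = mp (ren-⊢ ρ d) (ren-⊢ ρ e)
  ren-⊢ ρ (∀-R {ψ = ψ} {φ} d) = ∀-R (subst (λ x → T ⊢ (x ⇒ ren (liftR ρ) φ)) (ren-wk ρ ψ) (ren-⊢ (liftR ρ) d))
  ren-⊢ ρ (∃-R {ψ = ψ} {φ} d) = ∃-R (subst (λ x → T ⊢ (ren (liftR ρ) φ ⇒ x)) (ren-wk ρ ψ) (ren-⊢ (liftR ρ) d))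

  wk-⊢ : ∀ {n} {φ : Formula Lap n} → T ⊢ φ → T ⊢ wk φ
  wk-⊢ = ren-⊢ suc

  const : ∀ {n} {Γ φ : Formula Lap n} → T ⊢ φ → Γ ⊩ φ
  const = mp ax-K

  ⇒-elim : ∀ {n} {Γ φ ψ : Formula Lap n} → Γ ⊩ φ ⇒ ψ → Γ ⊩ φ → Γ ⊩ ψ
  ⇒-elim d e = mp (mp ax-S d) e

  ⊩-refl : ∀ {n} {φ : Formula Lap n} → φ ⊩ φ
  ⊩-refl {φ = φ} = ⇒-elim ax-K (ax-K {ψ = φ})

  infixr 9 _∘⊩_
  _∘⊩_ : ∀ {n} {A B C : Formula Lap n} → B ⊩ C → A ⊩ B → A ⊩ C
  d ∘⊩ e = ⇒-elim (const d) e

  ∧-intro : ∀ {n} {Γ φ ψ : Formula Lap n} → Γ ⊩ φ → Γ ⊩ ψ → Γ ⊩ φ ∧' ψ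
  ∧-intro d e = ⇒-elim (⇒-elim (const ax-∧I) d) e

  ∧-elim₁ : ∀ {n} {Γ φ ψ : Formula Lap n} → Γ ⊩ φ ∧' ψ → Γ ⊩ φ
  ∧-elim₁ d = ax-∧₁ ∘⊩ d

  ∧-elim₂ : ∀ {n} {Γ φ ψ : Formula Lap n} → Γ ⊩ φ ∧' ψ → Γ ⊩ ψ
  ∧-elim₂ d = ax-∧₂ ∘⊩ d

  assume : ∀ {n} {Γ φ : Formula Lap n} → Γ ∧' φ ⊩ φ
  assume = ax-∧₂

  weaken : ∀ {n} {Γ A φ : Formula Lap n} → Γ ⊩ φ → Γ ∧' A ⊩ φ
  weaken d = d ∘⊩ ax-∧₁

  ⇒-intro : ∀ {n} {Γ φ ψ : Formula Lap n} → Γ ∧' φ ⊩ ψ → Γ ⊩ φ ⇒ ψ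
  ⇒-intro {φ = φ} d = ⇒-elim (⇒-elim (const compose) (const d)) ax-∧I
    where
    compose : ∀ {A B} → T ⊢ ((A ⇒ B) ⇒ (φ ⇒ A) ⇒ φ ⇒ B)
    compose = ⇒-elim (const ax-S) ax-K

  ⊥-elim⊩ : ∀ {n} {Γ φ : Formula Lap n} → Γ ⊩ ⊥' → Γ ⊩ φ
  ⊥-elim⊩ d = (ax-DN ∘⊩ ax-K) ∘⊩ d

  ∨-intro₁ : ∀ {n} {Γ φ ψ : Formula Lap n} → Γ ⊩ φ → Γ ⊩ φ ∨' ψ
  ∨-intro₁ d = ax-∨₁ ∘⊩ d

  ∨-intro₂ : ∀ {n} {Γ φ ψ : Formula Lap n} → Γ ⊩ ψ → Γ ⊩ φ ∨' ψ
  ∨-intro₂ d = ax-∨₂ ∘⊩ d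

  ∨-elim : ∀ {n} {Γ φ ψ χ : Formula Lap n} → Γ ⊩ φ ∨' ψ → Γ ∧' φ ⊩ χ → Γ ∧' ψ ⊩ χ → Γ ⊩ χ
  ∨-elim d e f = ⇒-elim (⇒-elim (⇒-elim (const ax-∨E) (⇒-intro e)) (⇒-intro f)) d

  ∀-intro : ∀ {n} {Γ : Formula Lap n} {φ : Formula Lap (suc n)} → wk Γ ⊩ φ → Γ ⊩ ∀' φ
  ∀-intro = ∀-R

  ∀-elim : ∀ {n} {Γ : Formula Lap n} {φ : Formula Lap (suc n)} (t : Term n) → Γ ⊩ ∀' φ → Γ ⊩ φ [ t ]
  ∀-elim t d = ax-∀E t ∘⊩ d

  ∃-intro : ∀ {n} {Γ : Formula Lap n} {φ : Formula Lap (suc n)} (t : Term n) → Γ ⊩ φ [ t ] → Γ ⊩ ∃' φ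
  ∃-intro t d = ax-∃I t ∘⊩ d

  ∃-elim : ∀ {n} {Γ χ : Formula Lap n} {φ : Formula Lap (suc n)} → Γ ⊩ ∃' φ → wk Γ ∧' φ ⊩ wk χ → Γ ⊩ χ
  ∃-elim d e = ⇒-elim (⇒-elim (const (∃-R (⇒-intro (e ∘⊩ swap)))) d) ⊩-refl
    where
    swap : ∀ {n} {A B : Formula Lap n} → B ∧' A ⊩ A ∧' B
    swap = ∧-intro ax-∧₂ ax-∧₁

  discharge : ∀ {φ : Sentence Lap} → ⊥' ⇒ ⊥' ⊩ φ → T ⊢ φ
  discharge d = mp d ⊩-refl

  ¬∧₁ : ∀ {n} {Γ φ ψ : Formula Lap n} → Γ ⊩ ¬' φ → Γ ⊩ ¬' (φ ∧' ψ)
  ¬∧₁ d = ⇒-intro (⇒-elim (weaken d) (∧-elim₁ assume))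

  ¬∧₂ : ∀ {n} {Γ φ ψ : Formula Lap n} → Γ ⊩ ¬' ψ → Γ ⊩ ¬' (φ ∧' ψ)
  ¬∧₂ d = ⇒-intro (⇒-elim (weaken d) (∧-elim₂ assume))

  ≐-refl : ∀ {n} {Γ : Formula Lap n} (t : Term n) → Γ ⊩ t ≐ t
  ≐-refl t = const (ax-≐R t)

  ≐-transport : ∀ {n} {Γ : Formula Lap n} (φ : Formula Lap (suc n)) {s t : Term n} {X Y : Formula Lap n} →
                φ [ s ] ≡ X → φ [ t ] ≡ Y → Γ ⊩ s ≐ t → Γ ⊩ X → Γ ⊩ Y
  ≐-transport φ {s} {t} refl refl d e = ⇒-elim (⇒-elim (const (ax-≐L {φ = φ} s t)) d) e

  ≐-sym : ∀ {n} {Γ : Formula Lap n} {s t : Term n} → Γ ⊩ s ≐ t → Γ ⊩ t ≐ s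
  ≐-sym {s = s} {t} d =
    ≐-transport (var zero ≐ wkT s) (cong (s ≐_) (wkT-[] s s)) (cong (t ≐_) (wkT-[] t s)) d (≐-refl s)

  ≐-trans : ∀ {n} {Γ : Formula Lap n} {r s t : Term n} → Γ ⊩ r ≐ s → Γ ⊩ s ≐ t → Γ ⊩ r ≐ t
  ≐-trans {r = r} {s} {t} d e =
    ≐-transport (wkT r ≐ var zero) (cong (_≐ s) (wkT-[] s r)) (cong (_≐ t) (wkT-[] t r)) e d

  ≐-cong-S : ∀ {n} {Γ : Formula Lap n} {s t : Term n} → Γ ⊩ s ≐ t → Γ ⊩ S s ≐ S t
  ≐-cong-S {s = s} {t} d =
    ≐-transport (wkT (S s) ≐ S (var zero)) (cong (_≐ S s) (wkT-[] s (S s))) (cong (_≐ S t) (wkT-[] t (S s))) d (≐-refl (S s))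

  -- _∙_ stands for _⊕_ or _⊗_; the hypothesis holds by refl for both.
  ≐-cong-op : ∀ {n} {Γ : Formula Lap n} (_∙_ : ∀ {k} → Term k → Term k → Term k) →
              (∀ {k j} (σ : Fin k → Term j) x y → subT σ (x ∙ y) ≡ subT σ x ∙ subT σ y) →
              ∀ {a a′ b b′} → Γ ⊩ a ≐ a′ → Γ ⊩ b ≐ b′ → Γ ⊩ a ∙ b ≐ a′ ∙ b′
  ≐-cong-op {Γ = Γ} _∙_ sub-∙ {a} {a′} {b} {b′} d e = ≐-trans left right
    where
    left : Γ ⊩ a ∙ b ≐ a′ ∙ b
    left = ≐-transport (wkT (a ∙ b) ≐ var zero ∙ wkT b)
      (cong₂ _≐_ (wkT-[] a (a ∙ b)) (trans (sub-∙ (single a) _ _) (cong (a ∙_) (wkT-[] a b))))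
      (cong₂ _≐_ (wkT-[] a′ (a ∙ b)) (trans (sub-∙ (single a′) _ _) (cong (a′ ∙_) (wkT-[] a′ b))))
      d (≐-refl (a ∙ b))
    right : Γ ⊩ a′ ∙ b ≐ a′ ∙ b′
    right = ≐-transport (wkT (a′ ∙ b) ≐ wkT a′ ∙ var zero)
      (cong₂ _≐_ (wkT-[] b (a′ ∙ b)) (trans (sub-∙ (single b) _ _) (cong (_∙ b) (wkT-[] b a′))))
      (cong₂ _≐_ (wkT-[] b′ (a′ ∙ b)) (trans (sub-∙ (single b′) _ _) (cong (_∙ b′) (wkT-[] b′ a′))))
      e (≐-refl (a′ ∙ b))

  ≐-cong-⊕ : ∀ {n} {Γ : Formula Lap n} {a a′ b b′ : Term n} → Γ ⊩ a ≐ a′ → Γ ⊩ b ≐ b′ → Γ ⊩ a ⊕ b ≐ a′ ⊕ b′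
  ≐-cong-⊕ = ≐-cong-op _⊕_ (λ _ _ _ → refl)

  ≐-cong-⊗ : ∀ {n} {Γ : Formula Lap n} {a a′ b b′ : Term n} → Γ ⊩ a ≐ a′ → Γ ⊩ b ≐ b′ → Γ ⊩ a ⊗ b ≐ a′ ⊗ b′
  ≐-cong-⊗ = ≐-cong-op _⊗_ (λ _ _ _ → refl)

  ≼-resp-≐ : ∀ {n} {Γ : Formula Lap n} {a a′ b b′ : Term n} → Γ ⊩ a ≐ a′ → Γ ⊩ b ≐ b′ → Γ ⊩ a ≼ b → Γ ⊩ a′ ≼ b′
  ≼-resp-≐ {a = a} {a′} {b} {b′} d e f =
    ≐-transport (wkT a′ ≼ var zero) (cong (_≼ b) (wkT-[] b a′)) (cong (_≼ b′) (wkT-[] b′ a′)) e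
      (≐-transport (var zero ≼ wkT b) (cong (a ≼_) (wkT-[] a b)) (cong (a′ ≼_) (wkT-[] a′ b)) d f)

  P-resp-≐ : ∀ {n} {Γ : Formula Lap n} {a a′ : Term n} → Γ ⊩ a ≐ a′ → Γ ⊩ P a → Γ ⊩ P a′
  P-resp-≐ = ≐-transport (P (var zero)) refl refl

  instᵇ-≐ : ∀ {n m} {Γ : Formula Lap (suc m)} (e : Fin n → ℕ) (ψ : Formula La (suc n)) {a} →
            Γ ⊩ var zero ≐ num a → Γ ⊩ instᵇ e ψ → Γ ⊩ inst (extend a e) ψ
  instᵇ-≐ e ψ {a} = ≐-transport (instᵇ e ψ) (instᵇ-[var] e ψ) (instᵇ-[num] e ψ a)

  instᵇ-≐˘ : ∀ {n m} {Γ : Formula Lap (suc m)} (e : Fin n → ℕ) (ψ : Formula La (suc n)) {a} →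
             Γ ⊩ var zero ≐ num a → Γ ⊩ inst (extend a e) ψ → Γ ⊩ instᵇ e ψ
  instᵇ-≐˘ e ψ {a} d = ≐-transport (instᵇ e ψ) (instᵇ-[num] e ψ a) (instᵇ-[var] e ψ) (≐-sym d)

  bigOr-elim : ∀ {n} {Γ χ : Formula Lap n} {s : Term n} c → Γ ⊩ bigOr c [ s ] →
               (∀ i → i ≤ c → Γ ⊩ s ≐ num i ⇒ χ) → Γ ⊩ χ
  bigOr-elim zero d k = ⇒-elim (k zero z≤n) d
  bigOr-elim {Γ = Γ} {s = s} (suc c) d k =
    ∨-elim d (bigOr-elim c assume (λ i i≤c → weaken (k i (m≤n⇒m≤1+n i≤c))))
             (⇒-elim (weaken (k (suc c) ≤-refl))
                     (subst (λ x → Γ ∧' s ≐ x ⊩ s ≐ num (suc c)) (sym (subT-num (single s) (suc c))) assume))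

  bigOr-from-bound : ∀ {n} {Γ : Formula Lap n} {s : Term n} c →
                     Γ ⊩ ∀' (var zero ≼ num c ⇒ bigOr c) → Γ ⊩ s ≼ num c → Γ ⊩ bigOr c [ s ]
  bigOr-from-bound {Γ = Γ} {s} c d e = ⇒-elim (∀-elim s d) (subst (λ x → Γ ⊩ s ≼ x) (sym (subT-num (single s) c)) e)

  ∀≤-elim : ∀ {n k} {Γ : Formula Lap k} (τ : Fin n → Term k) (t : Term n) (φ : Formula Lap (suc n)) {u : Term k} →
            Γ ⊩ sub τ (∀' (var zero ≼ wkT t ⇒ φ)) → Γ ⊩ u ≼ subT τ t → Γ ⊩ sub (u ▸ τ) φ
  ∀≤-elim {Γ = Γ} τ t φ {u} d = ⇒-elim (subst₂ (λ x y → Γ ⊩ u ≼ x ⇒ y) (liftS-wkT-[] τ t u) (liftS-[] τ φ u) (∀-elim u d))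

  ∀≤-elim-num : ∀ {n m} {Γ : Formula Lap m} (e : Fin n → ℕ) (t : Term n) (ψ : Formula La (suc n)) {a} →
                Γ ⊩ inst e (∀' (var zero ≼ wkT t ⇒ ψ)) → Γ ⊩ num a ≼ instT e t → Γ ⊩ inst (extend a e) ψ
  ∀≤-elim-num {Γ = Γ} e t ψ d f =
    subst (Γ ⊩_) (sub-cong (λ { zero → refl ; (suc i) → refl }) (emb ψ)) (∀≤-elim (num ∘ e) t (emb ψ) d f)

  ∀≤-intro : ∀ {n m} {Γ : Formula Lap m} (e : Fin n → ℕ) (t : Term n) (ψ : Formula La (suc n)) {v} →
             wk Γ ∧' var zero ≼ instᵇT e t ⊩ bigOr v [ var zero ] →
             (∀ i → i ≤ v → wk Γ ∧' var zero ≼ instᵇT e t ⊩ inst (extend i e) ψ) →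
             Γ ⊩ inst e (∀' (var zero ≼ wkT t ⇒ ψ))
  ∀≤-intro e t ψ {v} below proofs =
    ∀-intro (⇒-intro (bigOr-elim v below λ i i≤v → ⇒-intro (instᵇ-≐˘ e ψ assume (weaken (proofs i i≤v)))))

  ∃≤-intro : ∀ {n m} {Γ : Formula Lap m} (e : Fin n → ℕ) (t : Term n) (ψ : Formula La (suc n)) {a} →
             Γ ⊩ num a ≼ instT e t → Γ ⊩ inst (extend a e) ψ → Γ ⊩ inst e (∃' (var zero ≼ wkT t ∧' ψ))
  ∃≤-intro {Γ = Γ} e t ψ {a} d f = ∃-intro (num a) (subst (Γ ⊩_) (sym shape) (∧-intro d f))
    where
    shape : (var zero ≼ instᵇT e t ∧' instᵇ e ψ) [ num a ] ≡ (num a ≼ instT e t ∧' inst (extend a e) ψ)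
    shape = cong₂ (λ x y → num a ≼ x ∧' y) (liftS-wkT-[] (num ∘ e) t (num a)) (instᵇ-[num] e ψ a)

  ∃≤-elim : ∀ {n m} {Γ : Formula Lap m} (e : Fin n → ℕ) (t : Term n) (ψ : Formula La (suc n)) {v} →
            Γ ⊩ inst e (∃' (var zero ≼ wkT t ∧' ψ)) →
            wk Γ ∧' (var zero ≼ instᵇT e t ∧' instᵇ e ψ) ⊩ bigOr v [ var zero ] →
            (∀ i → i ≤ v → wk Γ ∧' (var zero ≼ instᵇT e t ∧' instᵇ e ψ) ⊩ ¬' (inst (extend i e) ψ)) →
            Γ ⊩ ⊥'
  ∃≤-elim e t ψ {v} d below refutations = ∃-elim d (bigOr-elim v below λ i i≤v →
    ⇒-intro (⇒-elim (weaken (refutations i i≤v)) (instᵇ-≐ e ψ assume (weaken (∧-elim₂ assume)))))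

m≤1+n⇒m≤n∨m≡1+n : ∀ {m n} → m ≤ suc n → m ≤ n ⊎ m ≡ suc n
m≤1+n⇒m≤n∨m≡1+n p = Sum.map₁ m<1+n⇒m≤n (m≤n⇒m<n∨m≡n p)

extend-cong : ∀ {n} a {e e′ : Fin n → ℕ} → e ≗ e′ → extend a e ≗ extend a e′
extend-cong a h zero    = refl
extend-cong a h (suc i) = h i

extend-liftR : ∀ {n k} a (e : Fin k → ℕ) (ρ : Fin n → Fin k) → extend a e ∘ liftR ρ ≗ extend a (e ∘ ρ)
extend-liftR a e ρ zero    = refl
extend-liftR a e ρ (suc i) = refl

evalT-cong : ∀ {n} {e e′ : Fin n → ℕ} → e ≗ e′ → (t : Term n) → evalT e t ≡ evalT e′ t
evalT-cong h (var i) = h i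
evalT-cong h zer     = refl
evalT-cong h (S t)   = cong suc (evalT-cong h t)
evalT-cong h (s ⊕ t) = cong₂ _+_ (evalT-cong h s) (evalT-cong h t)
evalT-cong h (s ⊗ t) = cong₂ _*_ (evalT-cong h s) (evalT-cong h t)

evalT-ren : ∀ {n m} (e : Fin m → ℕ) (ρ : Fin n → Fin m) (t : Term n) → evalT e (renT ρ t) ≡ evalT (e ∘ ρ) t
evalT-ren e ρ (var i) = refl
evalT-ren e ρ zer     = refl
evalT-ren e ρ (S t)   = cong suc (evalT-ren e ρ t)
evalT-ren e ρ (s ⊕ t) = cong₂ _+_ (evalT-ren e ρ s) (evalT-ren e ρ t)
evalT-ren e ρ (s ⊗ t) = cong₂ _*_ (evalT-ren e ρ s) (evalT-ren e ρ t)

evalT-wkT : ∀ {n} a (e : Fin n → ℕ) (t : Term n) → evalT (extend a e) (wkT t) ≡ evalT e t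
evalT-wkT a e = evalT-ren (extend a e) suc


Sat-cong : ∀ {n} {e e′ : Fin n → ℕ} → e ≗ e′ → (φ : Formula La n) → Sat e φ → Sat e′ φ
Sat-cong h (s ≐ t)  x       = trans (sym (evalT-cong h s)) (trans x (evalT-cong h t))
Sat-cong h (s ≼ t)  x       = subst₂ _≤_ (evalT-cong h s) (evalT-cong h t) x
Sat-cong h ⊥'       x       = x
Sat-cong h (φ ⇒ ψ)  f       = λ y → Sat-cong h ψ (f (Sat-cong (sym ∘ h) φ y))
Sat-cong h (φ ∧' ψ) (x , y) = Sat-cong h φ x , Sat-cong h ψ y
Sat-cong h (φ ∨' ψ) x       = Sum.map (Sat-cong h φ) (Sat-cong h ψ) x
Sat-cong h (∀' φ)   f       = λ a → Sat-cong (extend-cong a h) φ (f a)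
Sat-cong h (∃' φ)   (a , x) = a , Sat-cong (extend-cong a h) φ x

bounded-search : ∀ (v : ℕ) {Q : ℕ → Set} → (∀ a → Dec (Q a)) →
                 (∀ a → a ≤ v → Q a) ⊎ Σ ℕ (λ a → a ≤ v × ¬ Q a)
bounded-search zero Q? with Q? zero
... | yes q = inj₁ λ { .zero z≤n → q }
... | no ¬q = inj₂ (zero , z≤n , ¬q)
bounded-search (suc v) Q? with bounded-search v Q? | Q? (suc v)
... | inj₂ (a , a≤v , ¬q) | _     = inj₂ (a , m≤n⇒m≤1+n a≤v , ¬q)
... | inj₁ below         | no ¬q = inj₂ (suc v , ≤-refl , ¬q)
... | inj₁ below         | yes q = inj₁ λ a a≤ → Sum.[ below a , (λ { refl → q }) ] (m≤1+n⇒m≤n∨m≡1+n a≤)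

Sat? : ∀ {n} {φ : Formula La n} → Bounded φ → (e : Fin n → ℕ) → Dec (Sat e φ)
Sat? (b≐ s t)  e = evalT e s ≟ evalT e t
Sat? (b≼ s t)  e = evalT e s ≤? evalT e t
Sat? b⊥        e = no λ ()
Sat? (b⇒ p q)  e = Sat? p e →-dec Sat? q e
Sat? (b∧ p q)  e = Sat? p e ×-dec Sat? q e
Sat? (b∨ p q)  e = Sat? p e ⊎-dec Sat? q e
Sat? (b∀≤ t p) e with bounded-search (evalT e t) (λ a → Sat? p (extend a e))
... | inj₁ all       = yes λ a a≤ → all a (subst (a ≤_) (evalT-wkT a e t) a≤)
... | inj₂ (a , a≤ , ¬s) = no λ h → ¬s (h a (subst (a ≤_) (sym (evalT-wkT a e t)) a≤))
Sat? (b∃≤ t p) e with bounded-search (evalT e t) (λ a → ¬? (Sat? p (extend a e)))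
... | inj₁ none      = no λ { (a , a≤ , s) → none a (subst (a ≤_) (evalT-wkT a e t) a≤) s }
... | inj₂ (a , a≤ , ¬¬s) with Sat? p (extend a e)
...   | yes s = yes (a , subst (a ≤_) (sym (evalT-wkT a e t)) a≤ , s)
...   | no ¬s = ⊥-elim (¬¬s ¬s)

peakT : ∀ {n} → (Fin n → ℕ) → Term n → ℕ
peakT e (var i) = e i
peakT e zer     = 0
peakT e (S t)   = suc (evalT e t) ⊔ peakT e t
peakT e (s ⊕ t) = (evalT e s + evalT e t) ⊔ (peakT e s ⊔ peakT e t)
peakT e (s ⊗ t) = (evalT e s * evalT e t) ⊔ (peakT e s ⊔ peakT e t)

evalT≤peakT : ∀ {n} (e : Fin n → ℕ) (t : Term n) → evalT e t ≤ peakT e t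
evalT≤peakT e (var i) = ≤-refl
evalT≤peakT e zer     = z≤n
evalT≤peakT e (S t)   = m≤m⊔n _ (peakT e t)
evalT≤peakT e (s ⊕ t) = m≤m⊔n _ (peakT e s ⊔ peakT e t)
evalT≤peakT e (s ⊗ t) = m≤m⊔n _ (peakT e s ⊔ peakT e t)

peakT-cong : ∀ {n} {e e′ : Fin n → ℕ} → e ≗ e′ → (t : Term n) → peakT e t ≡ peakT e′ t
peakT-cong h (var i) = h i
peakT-cong h zer     = refl
peakT-cong h (S t)   = cong₂ _⊔_ (cong suc (evalT-cong h t)) (peakT-cong h t)
peakT-cong h (s ⊕ t) = cong₂ _⊔_ (evalT-cong h (s ⊕ t)) (cong₂ _⊔_ (peakT-cong h s) (peakT-cong h t))
peakT-cong h (s ⊗ t) = cong₂ _⊔_ (evalT-cong h (s ⊗ t)) (cong₂ _⊔_ (peakT-cong h s) (peakT-cong h t))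

peakT-ren : ∀ {n m} (e : Fin m → ℕ) (ρ : Fin n → Fin m) (t : Term n) → peakT e (renT ρ t) ≡ peakT (e ∘ ρ) t
peakT-ren e ρ (var i) = refl
peakT-ren e ρ zer     = refl
peakT-ren e ρ (S t)   = cong₂ _⊔_ (cong suc (evalT-ren e ρ t)) (peakT-ren e ρ t)
peakT-ren e ρ (s ⊕ t) = cong₂ _⊔_ (evalT-ren e ρ (s ⊕ t)) (cong₂ _⊔_ (peakT-ren e ρ s) (peakT-ren e ρ t))
peakT-ren e ρ (s ⊗ t) = cong₂ _⊔_ (evalT-ren e ρ (s ⊗ t)) (cong₂ _⊔_ (peakT-ren e ρ s) (peakT-ren e ρ t))

maxUpTo : ℕ → (ℕ → ℕ) → ℕ
maxUpTo zero    f = f zero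
maxUpTo (suc v) f = maxUpTo v f ⊔ f (suc v)

≤-maxUpTo : ∀ v f {a} → a ≤ v → f a ≤ maxUpTo v f
≤-maxUpTo zero    f z≤n = ≤-refl
≤-maxUpTo (suc v) f a≤  with m≤1+n⇒m≤n∨m≡1+n a≤
... | inj₁ a≤v  = ≤-trans (≤-maxUpTo v f a≤v) (m≤m⊔n _ _)
... | inj₂ refl = m≤n⊔m _ _

maxUpTo-lub : ∀ v f {j} → (∀ a → a ≤ v → f a ≤ j) → maxUpTo v f ≤ j
maxUpTo-lub zero    f h = h zero z≤n
maxUpTo-lub (suc v) f h = ⊔-lub (maxUpTo-lub v f (λ a a≤ → h a (m≤n⇒m≤1+n a≤))) (h (suc v) ≤-refl)

maxUpTo-cong : ∀ v {f g : ℕ → ℕ} → f ≗ g → maxUpTo v f ≡ maxUpTo v g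
maxUpTo-cong zero    h = h zero
maxUpTo-cong (suc v) h = cong₂ _⊔_ (maxUpTo-cong v h) (h (suc v))

peakF : ∀ {n} {φ : Formula La n} → Bounded φ → (Fin n → ℕ) → ℕ
peakF (b≐ s t)  e = peakT e s ⊔ peakT e t
peakF (b≼ s t)  e = peakT e s ⊔ peakT e t
peakF b⊥        e = 0
peakF (b⇒ p q)  e = peakF p e ⊔ peakF q e
peakF (b∧ p q)  e = peakF p e ⊔ peakF q e
peakF (b∨ p q)  e = peakF p e ⊔ peakF q e
peakF (b∀≤ t p) e = peakT e t ⊔ maxUpTo (evalT e t) (λ a → peakF p (extend a e))
peakF (b∃≤ t p) e = peakT e t ⊔ maxUpTo (evalT e t) (λ a → peakF p (extend a e))

peakF-cong : ∀ {n} {φ : Formula La n} (b : Bounded φ) {e e′ : Fin n → ℕ} → e ≗ e′ → peakF b e ≡ peakF b e′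
peakF-cong (b≐ s t)  h = cong₂ _⊔_ (peakT-cong h s) (peakT-cong h t)
peakF-cong (b≼ s t)  h = cong₂ _⊔_ (peakT-cong h s) (peakT-cong h t)
peakF-cong b⊥        h = refl
peakF-cong (b⇒ p q)  h = cong₂ _⊔_ (peakF-cong p h) (peakF-cong q h)
peakF-cong (b∧ p q)  h = cong₂ _⊔_ (peakF-cong p h) (peakF-cong q h)
peakF-cong (b∨ p q)  h = cong₂ _⊔_ (peakF-cong p h) (peakF-cong q h)
peakF-cong (b∀≤ t p) {e} h = cong₂ _⊔_ (peakT-cong h t)
  (trans (cong (λ v → maxUpTo v (λ a → peakF p (extend a e))) (evalT-cong h t))
         (maxUpTo-cong (evalT _ t) (λ a → peakF-cong p (extend-cong a h))))
peakF-cong (b∃≤ t p) {e} h = cong₂ _⊔_ (peakT-cong h t)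
  (trans (cong (λ v → maxUpTo v (λ a → peakF p (extend a e))) (evalT-cong h t))
         (maxUpTo-cong (evalT _ t) (λ a → peakF-cong p (extend-cong a h))))

module BoundedCompleteness (T : Theory) where
  open Derivations T

  record R₀UpTo {m} (Γ : Formula Lap m) (N : ℕ) : Set where
    field
      add   : ∀ a c → a ≤ N → c ≤ N → a + c ≤ N → Γ ⊩ num a ⊕ num c ≐ num (a + c)
      mul   : ∀ a c → a ≤ N → c ≤ N → a * c ≤ N → Γ ⊩ num a ⊗ num c ≐ num (a * c)
      neq   : ∀ a c → a ≤ N → c ≤ N → a ≢ c → Γ ⊩ ¬' (num a ≐ num c)
      leq   : ∀ a c → a ≤ c → c ≤ N → Γ ⊩ num a ≼ num c
      bound : ∀ c → c ≤ N → Γ ⊩ ∀' (var zero ≼ num c ⇒ bigOr c)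
  open R₀UpTo public

  R₀UpTo-∧ : ∀ {m} {Γ A : Formula Lap m} {N} → R₀UpTo Γ N → R₀UpTo (Γ ∧' A) N
  R₀UpTo-∧ r = record
    { add   = λ a c p q s → weaken (add r a c p q s)
    ; mul   = λ a c p q s → weaken (mul r a c p q s)
    ; neq   = λ a c p q s → weaken (neq r a c p q s)
    ; leq   = λ a c p q → weaken (leq r a c p q)
    ; bound = λ c p → weaken (bound r c p) }

  R₀UpTo-wk : ∀ {m} {Γ : Formula Lap m} {N} → R₀UpTo Γ N → R₀UpTo (wk Γ) N
  R₀UpTo-wk {Γ = Γ} r = record
    { add   = λ a c p q s → subst (wk Γ ⊩_) (cong₂ _≐_ (cong₂ _⊕_ (rn a) (rn c)) (rn (a + c))) (wk-⊢ (add r a c p q s))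
    ; mul   = λ a c p q s → subst (wk Γ ⊩_) (cong₂ _≐_ (cong₂ _⊗_ (rn a) (rn c)) (rn (a * c))) (wk-⊢ (mul r a c p q s))
    ; neq   = λ a c p q s → subst (λ x → wk Γ ⊩ ¬' x) (cong₂ _≐_ (rn a) (rn c)) (wk-⊢ (neq r a c p q s))
    ; leq   = λ a c p q → subst (wk Γ ⊩_) (cong₂ _≼_ (rn a) (rn c)) (wk-⊢ (leq r a c p q))
    ; bound = λ c p → subst (wk Γ ⊩_) (ren-bound-axiom suc c) (wk-⊢ (bound r c p)) }
    where
    rn : ∀ k → renT suc (num k) ≡ num k
    rn = renT-num suc

  eval-term : ∀ {n m} {Γ : Formula Lap m} {N} → R₀UpTo Γ N → (e : Fin n → ℕ) (t : Term n) → peakT e t ≤ N →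
              Γ ⊩ instT e t ≐ num (evalT e t)
  eval-term r e (var i) h = ≐-refl _
  eval-term r e zer     h = ≐-refl _
  eval-term r e (S t)   h = ≐-cong-S (eval-term r e t (m⊔n≤o⇒n≤o _ (peakT e t) h))
  eval-term {N = N} r e (s ⊕ t) h = ≐-trans (≐-cong-⊕ (eval-term r e s hs) (eval-term r e t ht))
    (add r _ _ (≤-trans (evalT≤peakT e s) hs) (≤-trans (evalT≤peakT e t) ht) (m⊔n≤o⇒m≤o _ _ h))
    where
    hs : peakT e s ≤ N
    hs = m⊔n≤o⇒m≤o (peakT e s) _ (m⊔n≤o⇒n≤o (evalT e s + evalT e t) _ h)
    ht : peakT e t ≤ N
    ht = m⊔n≤o⇒n≤o (peakT e s) _ (m⊔n≤o⇒n≤o (evalT e s + evalT e t) _ h)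
  eval-term {N = N} r e (s ⊗ t) h = ≐-trans (≐-cong-⊗ (eval-term r e s hs) (eval-term r e t ht))
    (mul r _ _ (≤-trans (evalT≤peakT e s) hs) (≤-trans (evalT≤peakT e t) ht) (m⊔n≤o⇒m≤o _ _ h))
    where
    hs : peakT e s ≤ N
    hs = m⊔n≤o⇒m≤o (peakT e s) _ (m⊔n≤o⇒n≤o (evalT e s * evalT e t) _ h)
    ht : peakT e t ≤ N
    ht = m⊔n≤o⇒n≤o (peakT e s) _ (m⊔n≤o⇒n≤o (evalT e s * evalT e t) _ h)

  num≼instT : ∀ {n m} {Γ : Formula Lap m} {N} → R₀UpTo Γ N → (e : Fin n → ℕ) (t : Term n) → peakT e t ≤ N →
              ∀ {a} → a ≤ evalT e t → Γ ⊩ num a ≼ instT e t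
  num≼instT r e t h {a} a≤ =
    ≼-resp-≐ (≐-refl (num a)) (≐-sym (eval-term r e t h)) (leq r a _ a≤ (≤-trans (evalT≤peakT e t) h))

  below-bound : ∀ {n m} {Δ : Formula Lap (suc m)} {N} → R₀UpTo Δ N → (e : Fin n → ℕ) (t : Term n) → peakT e t ≤ N →
                Δ ⊩ var zero ≼ instᵇT e t → Δ ⊩ bigOr (evalT e t) [ var zero ]
  below-bound {Δ = Δ} r e t h d = bigOr-from-bound _ (bound r _ (≤-trans (evalT≤peakT e t) h))
    (≼-resp-≐ (≐-refl (var zero)) (subst (λ x → Δ ⊩ x ≐ num (evalT e t)) (sym (instᵇT≡instT e t)) (eval-term r e t h)) d)

  Decides : ∀ {n m} → Formula Lap m → (Fin n → ℕ) → Formula La n → Set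
  Decides Γ e φ = (Sat e φ → Γ ⊩ inst e φ) × (¬ Sat e φ → Γ ⊩ ¬' (inst e φ))

  decides-≐ : ∀ {n m} {Γ : Formula Lap m} {N} → R₀UpTo Γ N → (e : Fin n → ℕ) (s t : Term n) →
              peakT e s ≤ N → peakT e t ≤ N → Decides Γ e (s ≐ t)
  decides-≐ {Γ = Γ} r e s t hs ht = true , false
    where
    ds : Γ ⊩ instT e s ≐ num (evalT e s)
    ds = eval-term r e s hs
    dt : Γ ⊩ instT e t ≐ num (evalT e t)
    dt = eval-term r e t ht
    true : evalT e s ≡ evalT e t → Γ ⊩ instT e s ≐ instT e t
    true eq = ≐-trans ds (≐-sym (subst (λ x → Γ ⊩ instT e t ≐ num x) (sym eq) dt))
    false : evalT e s ≢ evalT e t → Γ ⊩ ¬' (instT e s ≐ instT e t)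
    false ne = ⇒-intro (⇒-elim (weaken (neq r _ _ (≤-trans (evalT≤peakT e s) hs) (≤-trans (evalT≤peakT e t) ht) ne))
                              (≐-trans (≐-sym (weaken ds)) (≐-trans assume (weaken dt))))

  decides-≼ : ∀ {n m} {Γ : Formula Lap m} {N} → R₀UpTo Γ N → (e : Fin n → ℕ) (s t : Term n) →
              peakT e s ≤ N → peakT e t ≤ N → Decides Γ e (s ≼ t)
  decides-≼ {Γ = Γ} {N} r e s t hs ht = true , false
    where
    ds : Γ ⊩ instT e s ≐ num (evalT e s)
    ds = eval-term r e s hs
    dt : Γ ⊩ instT e t ≐ num (evalT e t)
    dt = eval-term r e t ht
    vs≤N : evalT e s ≤ N
    vs≤N = ≤-trans (evalT≤peakT e s) hs
    vt≤N : evalT e t ≤ N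
    vt≤N = ≤-trans (evalT≤peakT e t) ht
    true : evalT e s ≤ evalT e t → Γ ⊩ instT e s ≼ instT e t
    true le = ≼-resp-≐ (≐-sym ds) (≐-sym dt) (leq r _ _ le vt≤N)
    -- below instT e t there are only the numerals i ≤ evalT e t, all different from evalT e s
    false : ¬ evalT e s ≤ evalT e t → Γ ⊩ ¬' (instT e s ≼ instT e t)
    false nle = ⇒-intro (bigOr-elim (evalT e t)
      (bigOr-from-bound _ (weaken (bound r _ vt≤N)) (≼-resp-≐ (weaken ds) (weaken dt) assume))
      λ i i≤ → weaken (neq r _ _ vs≤N (≤-trans i≤ vt≤N) λ { refl → <-irrefl refl (≤-<-trans i≤ (≰⇒> nle)) }))

  decides-⊥ : ∀ {n m} {Γ : Formula Lap m} (e : Fin n → ℕ) → Decides Γ e ⊥'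
  decides-⊥ e = (λ ()) , λ _ → const ⊩-refl

  decides-⇒ : ∀ {n m} {Γ : Formula Lap m} {e : Fin n → ℕ} {φ ψ : Formula La n} →
              Dec (Sat e φ) → Decides Γ e φ → Decides Γ e ψ → Decides Γ e (φ ⇒ ψ)
  decides-⇒ {Γ = Γ} {e} {φ} {ψ} φ? (φ⁺ , φ⁻) (ψ⁺ , ψ⁻) = true φ? , false φ?
    where
    true : Dec (Sat e φ) → Sat e (φ ⇒ ψ) → Γ ⊩ inst e (φ ⇒ ψ)
    true (yes sφ) h = ⇒-intro (weaken (ψ⁺ (h sφ)))
    true (no ¬sφ) h = ⇒-intro (⊥-elim⊩ (⇒-elim (weaken (φ⁻ ¬sφ)) assume))
    false : Dec (Sat e φ) → ¬ Sat e (φ ⇒ ψ) → Γ ⊩ ¬' (inst e (φ ⇒ ψ))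
    false (yes sφ) h = ⇒-intro (⇒-elim (weaken (ψ⁻ λ sψ → h λ _ → sψ)) (⇒-elim assume (weaken (φ⁺ sφ))))
    false (no ¬sφ) h = ⊥-elim (h λ sφ → ⊥-elim (¬sφ sφ))

  decides-∧ : ∀ {n m} {Γ : Formula Lap m} {e : Fin n → ℕ} {φ ψ : Formula La n} →
              Dec (Sat e φ) → Decides Γ e φ → Decides Γ e ψ → Decides Γ e (φ ∧' ψ)
  decides-∧ {Γ = Γ} {e} {φ} {ψ} φ? (φ⁺ , φ⁻) (ψ⁺ , ψ⁻) = (λ { (sφ , sψ) → ∧-intro (φ⁺ sφ) (ψ⁺ sψ) }) , false φ?
    where
    false : Dec (Sat e φ) → ¬ Sat e (φ ∧' ψ) → Γ ⊩ ¬' (inst e (φ ∧' ψ))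
    false (yes sφ) h = ¬∧₂ (ψ⁻ λ sψ → h (sφ , sψ))
    false (no ¬sφ) h = ¬∧₁ (φ⁻ ¬sφ)

  decides-∨ : ∀ {n m} {Γ : Formula Lap m} {e : Fin n → ℕ} {φ ψ : Formula La n} →
              Decides Γ e φ → Decides Γ e ψ → Decides Γ e (φ ∨' ψ)
  decides-∨ (φ⁺ , φ⁻) (ψ⁺ , ψ⁻) = Sum.[ ∨-intro₁ ∘ φ⁺ , ∨-intro₂ ∘ ψ⁺ ] , λ h →
    ⇒-intro (∨-elim assume (⇒-elim (weaken (weaken (φ⁻ (h ∘ inj₁)))) assume)
                           (⇒-elim (weaken (weaken (ψ⁻ (h ∘ inj₂)))) assume))

  -- polymorphic in the context: the instances are decided under fresh hypotheses
  DecidesBelow : ∀ {n} → ℕ → (Fin n → ℕ) → ℕ → Formula La (suc n) → Set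
  DecidesBelow N e v ψ = ∀ i → i ≤ v → ∀ {m} {Δ : Formula Lap m} → R₀UpTo Δ N → Decides Δ (extend i e) ψ

  decides-∀≤ : ∀ {n m} {Γ : Formula Lap m} {N} → R₀UpTo Γ N → (e : Fin n → ℕ) (t : Term n) {ψ : Formula La (suc n)} →
               peakT e t ≤ N → (∀ a → Dec (Sat (extend a e) ψ)) → DecidesBelow N e (evalT e t) ψ →
               Decides Γ e (∀' (var zero ≼ wkT t ⇒ ψ))
  decides-∀≤ {Γ = Γ} {N} r e t {ψ} h ψ? below = true , false
    where
    true : Sat e (∀' (var zero ≼ wkT t ⇒ ψ)) → Γ ⊩ inst e (∀' (var zero ≼ wkT t ⇒ ψ))
    true h∀ = ∀≤-intro e t ψ (below-bound rΔ e t h assume)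
      λ i i≤v → proj₁ (below i i≤v rΔ) (h∀ i (subst (i ≤_) (sym (evalT-wkT i e t)) i≤v))
      where
      rΔ : R₀UpTo (wk Γ ∧' var zero ≼ instᵇT e t) N
      rΔ = R₀UpTo-∧ (R₀UpTo-wk r)
    false : ¬ Sat e (∀' (var zero ≼ wkT t ⇒ ψ)) → Γ ⊩ ¬' (inst e (∀' (var zero ≼ wkT t ⇒ ψ)))
    false ¬h∀ with bounded-search (evalT e t) ψ?
    ... | inj₁ all = ⊥-elim (¬h∀ λ a a≤ → all a (subst (a ≤_) (evalT-wkT a e t) a≤))
    ... | inj₂ (a , a≤v , ¬s) =
      ⇒-intro (⇒-elim (weaken (proj₂ (below a a≤v r) ¬s)) (∀≤-elim-num e t ψ assume (weaken (num≼instT r e t h a≤v))))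

  decides-∃≤ : ∀ {n m} {Γ : Formula Lap m} {N} → R₀UpTo Γ N → (e : Fin n → ℕ) (t : Term n) {ψ : Formula La (suc n)} →
               peakT e t ≤ N → DecidesBelow N e (evalT e t) ψ → Decides Γ e (∃' (var zero ≼ wkT t ∧' ψ))
  decides-∃≤ {Γ = Γ} {N} r e t {ψ} h below = true , false
    where
    true : Sat e (∃' (var zero ≼ wkT t ∧' ψ)) → Γ ⊩ inst e (∃' (var zero ≼ wkT t ∧' ψ))
    true (a , a≤ , s) = ∃≤-intro e t ψ (num≼instT r e t h a≤v) (proj₁ (below a a≤v r) s)
      where
      a≤v : a ≤ evalT e t
      a≤v = subst (a ≤_) (evalT-wkT a e t) a≤
    false : ¬ Sat e (∃' (var zero ≼ wkT t ∧' ψ)) → Γ ⊩ ¬' (inst e (∃' (var zero ≼ wkT t ∧' ψ)))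
    false ¬h∃ = ⇒-intro (∃≤-elim e t ψ assume (below-bound rΔ e t h (∧-elim₁ assume))
      λ i i≤v → proj₂ (below i i≤v rΔ) λ s → ¬h∃ (i , subst (i ≤_) (sym (evalT-wkT i e t)) i≤v , s))
      where
      rΔ : R₀UpTo (wk (Γ ∧' inst e (∃' (var zero ≼ wkT t ∧' ψ))) ∧' (var zero ≼ instᵇT e t ∧' instᵇ e ψ)) N
      rΔ = R₀UpTo-∧ (R₀UpTo-wk (R₀UpTo-∧ r))

  bounded-decides : ∀ {n} {φ : Formula La n} (b : Bounded φ) (e : Fin n → ℕ) {m} {Γ : Formula Lap m} {N} →
                    R₀UpTo Γ N → peakF b e ≤ N → Decides Γ e φ
  bounded-decides (b≐ s t)  e r h = decides-≐ r e s t (m⊔n≤o⇒m≤o _ _ h) (m⊔n≤o⇒n≤o (peakT e s) _ h)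
  bounded-decides (b≼ s t)  e r h = decides-≼ r e s t (m⊔n≤o⇒m≤o _ _ h) (m⊔n≤o⇒n≤o (peakT e s) _ h)
  bounded-decides b⊥        e r h = decides-⊥ e
  bounded-decides (b⇒ p q)  e r h =
    decides-⇒ (Sat? p e) (bounded-decides p e r (m⊔n≤o⇒m≤o _ _ h)) (bounded-decides q e r (m⊔n≤o⇒n≤o (peakF p e) _ h))
  bounded-decides (b∧ p q)  e r h =
    decides-∧ (Sat? p e) (bounded-decides p e r (m⊔n≤o⇒m≤o _ _ h)) (bounded-decides q e r (m⊔n≤o⇒n≤o (peakF p e) _ h))
  bounded-decides (b∨ p q)  e r h =
    decides-∨ (bounded-decides p e r (m⊔n≤o⇒m≤o _ _ h)) (bounded-decides q e r (m⊔n≤o⇒n≤o (peakF p e) _ h))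
  bounded-decides (b∀≤ t p) e r h =
    decides-∀≤ r e t (m⊔n≤o⇒m≤o _ _ h) (λ a → Sat? p (extend a e))
      λ i i≤ r′ → bounded-decides p (extend i e) r′ (≤-trans (≤-maxUpTo _ _ i≤) (m⊔n≤o⇒n≤o (peakT e t) _ h))
  bounded-decides (b∃≤ t p) e r h =
    decides-∃≤ r e t (m⊔n≤o⇒m≤o _ _ h)
      λ i i≤ r′ → bounded-decides p (extend i e) r′ (≤-trans (≤-maxUpTo _ _ i≤) (m⊔n≤o⇒n≤o (peakT e t) _ h))

FitsT : ∀ {n k} → (Fin n → Fin k) → Term k → Term n → Formula La k
FitsT ρ u (var i) = var (ρ i) ≼ u
FitsT ρ u zer     = zer ≼ u
FitsT ρ u (S t)   = FitsT ρ u t ∧' renT ρ (S t) ≼ u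
FitsT ρ u (s ⊕ t) = (FitsT ρ u s ∧' FitsT ρ u t) ∧' renT ρ (s ⊕ t) ≼ u
FitsT ρ u (s ⊗ t) = (FitsT ρ u s ∧' FitsT ρ u t) ∧' renT ρ (s ⊗ t) ≼ u

FitsBelow : ∀ {n k} → (Fin n → Fin k) → Term k → Term n → Formula La (suc k) → Formula La k
FitsBelow ρ u t F = FitsT ρ u t ∧' ∀' (var zero ≼ wkT (renT ρ t) ⇒ F)

Fits : ∀ {n k} {φ : Formula La n} → (Fin n → Fin k) → Term k → Bounded φ → Formula La k
Fits ρ u (b≐ s t)  = FitsT ρ u s ∧' FitsT ρ u t
Fits ρ u (b≼ s t)  = FitsT ρ u s ∧' FitsT ρ u t
Fits ρ u b⊥        = ⊥' ⇒ ⊥'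
Fits ρ u (b⇒ p q)  = Fits ρ u p ∧' Fits ρ u q
Fits ρ u (b∧ p q)  = Fits ρ u p ∧' Fits ρ u q
Fits ρ u (b∨ p q)  = Fits ρ u p ∧' Fits ρ u q
Fits ρ u (b∀≤ t p) = FitsBelow ρ u t (Fits (liftR ρ) (wkT u) p)
Fits ρ u (b∃≤ t p) = FitsBelow ρ u t (Fits (liftR ρ) (wkT u) p)

FitsT-bounded : ∀ {n k} (ρ : Fin n → Fin k) (u : Term k) (t : Term n) → Bounded (FitsT ρ u t)
FitsT-bounded ρ u (var i) = b≼ _ _
FitsT-bounded ρ u zer     = b≼ _ _
FitsT-bounded ρ u (S t)   = b∧ (FitsT-bounded ρ u t) (b≼ _ _)
FitsT-bounded ρ u (s ⊕ t) = b∧ (b∧ (FitsT-bounded ρ u s) (FitsT-bounded ρ u t)) (b≼ _ _)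
FitsT-bounded ρ u (s ⊗ t) = b∧ (b∧ (FitsT-bounded ρ u s) (FitsT-bounded ρ u t)) (b≼ _ _)

Fits-bounded : ∀ {n k} {φ : Formula La n} (ρ : Fin n → Fin k) (u : Term k) (b : Bounded φ) → Bounded (Fits ρ u b)
Fits-bounded ρ u (b≐ s t)  = b∧ (FitsT-bounded ρ u s) (FitsT-bounded ρ u t)
Fits-bounded ρ u (b≼ s t)  = b∧ (FitsT-bounded ρ u s) (FitsT-bounded ρ u t)
Fits-bounded ρ u b⊥        = b⇒ b⊥ b⊥
Fits-bounded ρ u (b⇒ p q)  = b∧ (Fits-bounded ρ u p) (Fits-bounded ρ u q)
Fits-bounded ρ u (b∧ p q)  = b∧ (Fits-bounded ρ u p) (Fits-bounded ρ u q)
Fits-bounded ρ u (b∨ p q)  = b∧ (Fits-bounded ρ u p) (Fits-bounded ρ u q)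
Fits-bounded ρ u (b∀≤ t p) = b∧ (FitsT-bounded ρ u t) (b∀≤ (renT ρ t) (Fits-bounded (liftR ρ) (wkT u) p))
Fits-bounded ρ u (b∃≤ t p) = b∧ (FitsT-bounded ρ u t) (b∀≤ (renT ρ t) (Fits-bounded (liftR ρ) (wkT u) p))

FitsT-sat : ∀ {n k} (ρ : Fin n → Fin k) (u : Term k) (e : Fin k → ℕ) (t : Term n) →
            peakT (e ∘ ρ) t ≤ evalT e u → Sat e (FitsT ρ u t)
FitsT-sat ρ u e (var i) h = h
FitsT-sat ρ u e zer     h = z≤n
FitsT-sat ρ u e (S t)   h =
  FitsT-sat ρ u e t (m⊔n≤o⇒n≤o _ _ h) , subst (_≤ evalT e u) (sym (evalT-ren e ρ (S t))) (m⊔n≤o⇒m≤o _ (peakT (e ∘ ρ) t) h)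
FitsT-sat ρ u e (s ⊕ t) h =
  (FitsT-sat ρ u e s (m⊔n≤o⇒m≤o _ _ hst) , FitsT-sat ρ u e t (m⊔n≤o⇒n≤o (peakT (e ∘ ρ) s) _ hst)) ,
  subst (_≤ evalT e u) (sym (evalT-ren e ρ (s ⊕ t))) (m⊔n≤o⇒m≤o _ (peakT (e ∘ ρ) s ⊔ _) h)
  where
  hst : peakT (e ∘ ρ) s ⊔ peakT (e ∘ ρ) t ≤ evalT e u
  hst = m⊔n≤o⇒n≤o (evalT (e ∘ ρ) (s ⊕ t)) _ h
FitsT-sat ρ u e (s ⊗ t) h =
  (FitsT-sat ρ u e s (m⊔n≤o⇒m≤o _ _ hst) , FitsT-sat ρ u e t (m⊔n≤o⇒n≤o (peakT (e ∘ ρ) s) _ hst)) ,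
  subst (_≤ evalT e u) (sym (evalT-ren e ρ (s ⊗ t))) (m⊔n≤o⇒m≤o _ (peakT (e ∘ ρ) s ⊔ _) h)
  where
  hst : peakT (e ∘ ρ) s ⊔ peakT (e ∘ ρ) t ≤ evalT e u
  hst = m⊔n≤o⇒n≤o (evalT (e ∘ ρ) (s ⊗ t)) _ h

FitsBelow-sat : ∀ {n k} (ρ : Fin n → Fin k) (u : Term k) (t : Term n) {ψ : Formula La (suc n)} (p : Bounded ψ)
                (e : Fin k → ℕ) {F : Formula La (suc k)} →
                peakT (e ∘ ρ) t ⊔ maxUpTo (evalT (e ∘ ρ) t) (λ a → peakF p (extend a (e ∘ ρ))) ≤ evalT e u →
                (∀ y → peakF p (extend y e ∘ liftR ρ) ≤ evalT (extend y e) (wkT u) → Sat (extend y e) F) →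
                Sat e (FitsBelow ρ u t F)
FitsBelow-sat ρ u t p e h fits = FitsT-sat ρ u e t (m⊔n≤o⇒m≤o _ _ h) , λ y y≤ → fits y (peak≤ y y≤)
  where
  peak≤ : ∀ y → y ≤ evalT (extend y e) (wkT (renT ρ t)) → peakF p (extend y e ∘ liftR ρ) ≤ evalT (extend y e) (wkT u)
  peak≤ y y≤ = subst₂ _≤_ (sym (peakF-cong p (extend-liftR y e ρ))) (sym (evalT-wkT y e u))
    (≤-trans (≤-maxUpTo _ (λ a → peakF p (extend a (e ∘ ρ))) (subst (y ≤_) (trans (evalT-wkT y e (renT ρ t)) (evalT-ren e ρ t)) y≤))
             (m⊔n≤o⇒n≤o (peakT (e ∘ ρ) t) _ h))

Fits-sat : ∀ {n k} {φ : Formula La n} (ρ : Fin n → Fin k) (u : Term k) (b : Bounded φ) (e : Fin k → ℕ) →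
           peakF b (e ∘ ρ) ≤ evalT e u → Sat e (Fits ρ u b)
Fits-sat ρ u (b≐ s t)  e h = FitsT-sat ρ u e s (m⊔n≤o⇒m≤o _ _ h) , FitsT-sat ρ u e t (m⊔n≤o⇒n≤o (peakT (e ∘ ρ) s) _ h)
Fits-sat ρ u (b≼ s t)  e h = FitsT-sat ρ u e s (m⊔n≤o⇒m≤o _ _ h) , FitsT-sat ρ u e t (m⊔n≤o⇒n≤o (peakT (e ∘ ρ) s) _ h)
Fits-sat ρ u b⊥        e h = λ x → x
Fits-sat ρ u (b⇒ p q)  e h = Fits-sat ρ u p e (m⊔n≤o⇒m≤o _ _ h) , Fits-sat ρ u q e (m⊔n≤o⇒n≤o (peakF p (e ∘ ρ)) _ h)
Fits-sat ρ u (b∧ p q)  e h = Fits-sat ρ u p e (m⊔n≤o⇒m≤o _ _ h) , Fits-sat ρ u q e (m⊔n≤o⇒n≤o (peakF p (e ∘ ρ)) _ h)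
Fits-sat ρ u (b∨ p q)  e h = Fits-sat ρ u p e (m⊔n≤o⇒m≤o _ _ h) , Fits-sat ρ u q e (m⊔n≤o⇒n≤o (peakF p (e ∘ ρ)) _ h)
Fits-sat ρ u (b∀≤ t p) e h = FitsBelow-sat ρ u t p e h (λ y → Fits-sat (liftR ρ) (wkT u) p (extend y e))
Fits-sat ρ u (b∃≤ t p) e h = FitsBelow-sat ρ u t p e h (λ y → Fits-sat (liftR ρ) (wkT u) p (extend y e))

x₀ : ∀ {n} → Term (suc n)
x₀ = var zero

x₁ : ∀ {n} → Term (suc (suc n))
x₁ = var (suc zero)

x₂ : ∀ {n} → Term (suc (suc (suc n)))
x₂ = var (suc (suc zero))

-- de Bruijn: in ∀' (x₀ ≼ x₁ ⇒ …) the bound variable is x₀ and x itself is x₁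
Loc-axioms : Vec (Formula La 1) 15
Loc-axioms =
  ∀' (x₀ ≼ x₁ ⇒ x₀ ⊕ zer ≐ x₀) ∷
  ∀' (x₀ ≼ x₁ ⇒ ∀' (x₀ ≼ x₂ ⇒ x₁ ⊕ S x₀ ≐ S (x₁ ⊕ x₀))) ∷
  ∀' (x₀ ≼ x₁ ⇒ x₀ ⊗ zer ≐ zer) ∷
  ∀' (x₀ ≼ x₁ ⇒ ∀' (x₀ ≼ x₂ ⇒ x₁ ⊗ S x₀ ≐ (x₁ ⊗ x₀) ⊕ x₁)) ∷
  ∀' (x₀ ≼ x₁ ⇒ ¬' (S x₀ ≐ zer)) ∷
  ∀' (x₀ ≼ x₁ ⇒ ∀' (x₀ ≼ x₂ ⇒ S x₁ ≐ S x₀ ⇒ x₁ ≐ x₀)) ∷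
  ∀' (x₀ ≼ zer ⇒ x₀ ≐ zer) ∷
  ∀' (x₀ ≼ x₁ ⇒ ∀' (x₀ ≼ S x₁ ⇒ x₀ ≼ x₁ ∨' x₀ ≐ S x₁)) ∷
  ∀' (x₀ ≼ x₁ ⇒ x₀ ≐ x₁ ∨' S x₀ ≼ x₁) ∷
  zer ≼ x₀ ∷
  ∀' (x₀ ≼ x₁ ⇒ x₀ ≼ x₀) ∷
  ∀' (x₀ ≼ x₁ ⇒ ∀' (x₀ ≼ x₂ ⇒ x₁ ≼ x₀ ⇒ x₁ ≼ S x₀)) ∷
  ∀' (x₀ ≼ x₁ ⇒ ∀' (x₀ ≼ x₂ ⇒ x₁ ⊕ S x₀ ≼ x₂ ⇒ x₁ ⊕ x₀ ≼ x₂ ∧' ¬' (x₁ ⊕ x₀ ≐ x₂))) ∷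
  ∀' (x₀ ≼ x₁ ⇒ ∀' (x₀ ≼ x₂ ⇒ x₁ ⊗ S x₀ ≼ x₂ ⇒ x₁ ⊗ x₀ ≼ x₂)) ∷
  ¬' (S x₀ ≼ x₀) ∷
  []

⋀ : ∀ {L n k} → Vec (Formula L n) k → Formula L n
⋀ []       = ⊥' ⇒ ⊥'
⋀ (φ ∷ φs) = φ ∧' ⋀ φs

⋀-bounded : ∀ {n k} {φs : Vec (Formula La n) k} → All Bounded φs → Bounded (⋀ φs)
⋀-bounded []       = b⇒ b⊥ b⊥
⋀-bounded (b ∷ bs) = b∧ b (⋀-bounded bs)

Loc : Formula La 1
Loc = ⋀ Loc-axioms

Loc-bounded : Bounded Loc
Loc-bounded = ⋀-bounded
  ( b∀≤ x₀ (b≐ _ _) ∷ b∀≤ x₀ (b∀≤ x₁ (b≐ _ _)) ∷ b∀≤ x₀ (b≐ _ _) ∷ b∀≤ x₀ (b∀≤ x₁ (b≐ _ _)) ∷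
    b∀≤ x₀ (b⇒ (b≐ _ _) b⊥) ∷ b∀≤ x₀ (b∀≤ x₁ (b⇒ (b≐ _ _) (b≐ _ _))) ∷ b∀≤ zer (b≐ _ _) ∷
    b∀≤ x₀ (b∀≤ (S x₀) (b∨ (b≼ _ _) (b≐ _ _))) ∷ b∀≤ x₀ (b∨ (b≐ _ _) (b≼ _ _)) ∷ b≼ _ _ ∷
    b∀≤ x₀ (b≼ _ _) ∷ b∀≤ x₀ (b∀≤ x₁ (b⇒ (b≼ _ _) (b≼ _ _))) ∷
    b∀≤ x₀ (b∀≤ x₁ (b⇒ (b≼ _ _) (b∧ (b≼ _ _) (b⇒ (b≐ _ _) b⊥)))) ∷
    b∀≤ x₀ (b∀≤ x₁ (b⇒ (b≼ _ _) (b≼ _ _))) ∷ b⇒ (b≼ _ _) b⊥ ∷ [] )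

Loc-true : (e : Fin 1 → ℕ) → Sat e Loc
Loc-true e =
  (λ a _ → +-identityʳ a) ,
  (λ a _ c _ → +-suc a c) ,
  (λ a _ → *-zeroʳ a) ,
  (λ a _ c _ → trans (*-suc a c) (+-comm a (a * c))) ,
  (λ a _ ()) ,
  (λ a _ c _ → suc-injective) ,
  (λ a a≤0 → n≤0⇒n≡0 a≤0) ,
  (λ c _ a a≤ → m≤1+n⇒m≤n∨m≡1+n a≤) ,
  (λ a a≤ → Sum.swap (m≤n⇒m<n∨m≡n a≤)) ,
  z≤n ,
  (λ a _ → ≤-refl) ,
  (λ a _ c _ → m≤n⇒m≤1+n) ,
  (λ a _ c _ a+1+c≤ → let a+c<x = subst (_≤ e zero) (+-suc a c) a+1+c≤
                      in <⇒≤ a+c<x , λ eq → <-irrefl eq a+c<x) ,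
  (λ a _ c _ → ≤-trans (*-monoʳ-≤ a (n≤1+n c))) ,
  (λ 1+x≤x → <-irrefl refl 1+x≤x) ,
  λ ()

LocX : ∀ {k} → Term k → Formula Lap k
LocX X = sub (λ _ → X) (emb Loc)

module LocalArithmetic (T : Theory) where
  open Derivations T
  open BoundedCompleteness T

  ⋀-lookup : ∀ {n k m} {Γ : Formula Lap m} (τ : Fin n → Term m) (φs : Vec (Formula La n) k) (i : Fin k) →
             Γ ⊩ sub τ (emb (⋀ φs)) → Γ ⊩ sub τ (emb (lookup φs i))
  ⋀-lookup τ (φ ∷ φs) zero    d = ∧-elim₁ d
  ⋀-lookup τ (φ ∷ φs) (suc i) d = ⋀-lookup τ φs i (∧-elim₂ d)

  wk-LocX : ∀ {k} {Γ : Formula Lap k} {X : Term k} → Γ ⊩ LocX X → wk Γ ⊩ LocX (wkT X)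
  wk-LocX {Γ = Γ} {X} d = subst (wk Γ ⊩_) (ren-sub suc (λ _ → X) (emb Loc)) (wk-⊢ d)

  module LocFacts {k} {Γ : Formula Lap k} {X : Term k} (loc : Γ ⊩ LocX X) where

    private
      axiom : (i : Fin 15) → Γ ⊩ sub (λ _ → X) (emb (lookup Loc-axioms i))
      axiom i = ⋀-lookup _ Loc-axioms i loc

      below₁ : ∀ {A} (φ : Formula La 2) → Γ ⊩ sub (λ _ → X) (emb (∀' (x₀ ≼ x₁ ⇒ φ))) →
               Γ ⊩ A ≼ X → Γ ⊩ sub (A ▸ λ _ → X) (emb φ)
      below₁ φ = ∀≤-elim _ x₀ (emb φ)

      below₂ : ∀ {A C} (φ : Formula La 3) → Γ ⊩ sub (λ _ → X) (emb (∀' (x₀ ≼ x₁ ⇒ ∀' (x₀ ≼ x₂ ⇒ φ)))) →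
               Γ ⊩ A ≼ X → Γ ⊩ C ≼ X → Γ ⊩ sub (C ▸ (A ▸ λ _ → X)) (emb φ)
      below₂ φ d a≼ = ∀≤-elim _ x₁ (emb φ) (∀≤-elim _ x₀ (emb (∀' (x₀ ≼ x₂ ⇒ φ))) d a≼)

    ⊕-zer : ∀ {A} → Γ ⊩ A ≼ X → Γ ⊩ A ⊕ zer ≐ A
    ⊕-zer = below₁ (x₀ ⊕ zer ≐ x₀) (axiom (# 0))

    ⊕-S : ∀ {A C} → Γ ⊩ A ≼ X → Γ ⊩ C ≼ X → Γ ⊩ A ⊕ S C ≐ S (A ⊕ C)
    ⊕-S = below₂ (x₁ ⊕ S x₀ ≐ S (x₁ ⊕ x₀)) (axiom (# 1))

    ⊗-zer : ∀ {A} → Γ ⊩ A ≼ X → Γ ⊩ A ⊗ zer ≐ zer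
    ⊗-zer = below₁ (x₀ ⊗ zer ≐ zer) (axiom (# 2))

    ⊗-S : ∀ {A C} → Γ ⊩ A ≼ X → Γ ⊩ C ≼ X → Γ ⊩ A ⊗ S C ≐ (A ⊗ C) ⊕ A
    ⊗-S = below₂ (x₁ ⊗ S x₀ ≐ (x₁ ⊗ x₀) ⊕ x₁) (axiom (# 3))

    S≢zer : ∀ {A} → Γ ⊩ A ≼ X → Γ ⊩ ¬' (S A ≐ zer)
    S≢zer = below₁ (¬' (S x₀ ≐ zer)) (axiom (# 4))

    S-injective : ∀ {A C} → Γ ⊩ A ≼ X → Γ ⊩ C ≼ X → Γ ⊩ S A ≐ S C ⇒ A ≐ C
    S-injective = below₂ (S x₁ ≐ S x₀ ⇒ x₁ ≐ x₀) (axiom (# 5))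

    ≼zer : Γ ⊩ ∀' (var zero ≼ num 0 ⇒ bigOr 0)
    ≼zer = axiom (# 6)

    ≼S-cases : ∀ {A C} → Γ ⊩ A ≼ X → Γ ⊩ C ≼ S A → Γ ⊩ C ≼ A ∨' C ≐ S A
    ≼S-cases {A} a≼ = ∀≤-elim (A ▸ λ (_ : Fin 1) → X) (S x₀) (emb (x₀ ≼ x₁ ∨' x₀ ≐ S x₁))
      (below₁ (∀' (x₀ ≼ S x₁ ⇒ x₀ ≼ x₁ ∨' x₀ ≐ S x₁)) (axiom (# 7)) a≼)

    ≼X-cases : ∀ {A} → Γ ⊩ A ≼ X → Γ ⊩ A ≐ X ∨' S A ≼ X
    ≼X-cases = below₁ (x₀ ≐ x₁ ∨' S x₀ ≼ x₁) (axiom (# 8))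

    zer≼X : Γ ⊩ zer ≼ X
    zer≼X = axiom (# 9)

    ≼-refl : ∀ {A} → Γ ⊩ A ≼ X → Γ ⊩ A ≼ A
    ≼-refl = below₁ (x₀ ≼ x₀) (axiom (# 10))

    ≼-step : ∀ {A C} → Γ ⊩ A ≼ X → Γ ⊩ C ≼ X → Γ ⊩ A ≼ C ⇒ A ≼ S C
    ≼-step = below₂ (x₁ ≼ x₀ ⇒ x₁ ≼ S x₀) (axiom (# 11))

    ⊕-overflow : ∀ {A C} → Γ ⊩ A ≼ X → Γ ⊩ C ≼ X → Γ ⊩ A ⊕ S C ≼ X ⇒ A ⊕ C ≼ X ∧' ¬' (A ⊕ C ≐ X)
    ⊕-overflow = below₂ (x₁ ⊕ S x₀ ≼ x₂ ⇒ x₁ ⊕ x₀ ≼ x₂ ∧' ¬' (x₁ ⊕ x₀ ≐ x₂)) (axiom (# 12))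

    ⊗-overflow : ∀ {A C} → Γ ⊩ A ≼ X → Γ ⊩ C ≼ X → Γ ⊩ A ⊗ S C ≼ X ⇒ A ⊗ C ≼ X
    ⊗-overflow = below₂ (x₁ ⊗ S x₀ ≼ x₂ ⇒ x₁ ⊗ x₀ ≼ x₂) (axiom (# 13))

    S-overflow : Γ ⊩ ¬' (S X ≼ X)
    S-overflow = axiom (# 14)

  wk-num≼ : ∀ {k} {Γ : Formula Lap k} {X : Term k} a → Γ ⊩ num a ≼ X → wk Γ ⊩ num a ≼ wkT X
  wk-num≼ {Γ = Γ} {X} a d = subst (λ x → wk Γ ⊩ x ≼ wkT X) (renT-num suc a) (wk-⊢ d)

  Loc-bound : ∀ {k} {Γ : Formula Lap k} {X : Term k} {N} → Γ ⊩ LocX X → (∀ a → a ≤ N → Γ ⊩ num a ≼ X) →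
              ∀ c → c ≤ N → Γ ⊩ ∀' (var zero ≼ num c ⇒ bigOr c)
  Loc-bound loc below zero    c≤ = LocFacts.≼zer loc
  Loc-bound {Γ = Γ} loc below (suc c) c≤ =
    ∀-intro (⇒-intro (∨-elim (LocFacts.≼S-cases (weaken (wk-LocX loc)) (weaken (wk-num≼ c (below c (<⇒≤ c≤)))) assume)
      (∨-intro₁ (subst ((wk Γ ∧' var zero ≼ num (suc c)) ∧' var zero ≼ num c ⊩_) (bigOr-[var] c)
                       (bigOr-from-bound c (weaken (weaken wk-bound)) assume)))
      (∨-intro₂ assume)))
    where
    wk-bound : wk Γ ⊩ ∀' (var zero ≼ num c ⇒ bigOr c)
    wk-bound = subst (wk Γ ⊩_) (ren-bound-axiom suc c) (wk-⊢ (Loc-bound loc below c (<⇒≤ c≤)))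

  module _ {k} {Γ : Formula Lap k} {X : Term k} {N : ℕ} (loc : Γ ⊩ LocX X) (below : ∀ a → a ≤ N → Γ ⊩ num a ≼ X) where
    open LocFacts loc

    Loc-+ : ∀ a c → a ≤ N → c ≤ N → Γ ⊩ num a ⊕ num c ≐ num (a + c)
    Loc-+ a zero    a≤ c≤ = subst (λ x → Γ ⊩ num a ⊕ zer ≐ num x) (sym (+-identityʳ a)) (⊕-zer (below a a≤))
    Loc-+ a (suc c) a≤ c≤ = subst (λ x → Γ ⊩ num a ⊕ num (suc c) ≐ num x) (sym (+-suc a c))
      (≐-trans (⊕-S (below a a≤) (below c (<⇒≤ c≤))) (≐-cong-S (Loc-+ a c a≤ (<⇒≤ c≤))))

    Loc-* : ∀ a c → a ≤ N → c ≤ N → a * c ≤ N → Γ ⊩ num a ⊗ num c ≐ num (a * c)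
    Loc-* a zero    a≤ c≤ ac≤ = subst (λ x → Γ ⊩ num a ⊗ zer ≐ num x) (sym (*-zeroʳ a)) (⊗-zer (below a a≤))
    Loc-* a (suc c) a≤ c≤ ac≤ = subst (λ x → Γ ⊩ num a ⊗ num (suc c) ≐ num x) (sym (trans (*-suc a c) (+-comm a (a * c))))
      (≐-trans (⊗-S (below a a≤) (below c (<⇒≤ c≤)))
               (≐-trans (≐-cong-⊕ (Loc-* a c a≤ (<⇒≤ c≤) a*c≤) (≐-refl (num a))) (Loc-+ (a * c) a a*c≤ a≤)))
      where
      a*c≤ : a * c ≤ N
      a*c≤ = ≤-trans (*-monoʳ-≤ a (n≤1+n c)) ac≤

    Loc-≢ : ∀ a c → a ≤ N → c ≤ N → a ≢ c → Γ ⊩ ¬' (num a ≐ num c)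
    Loc-≢ zero    zero    a≤ c≤ a≢c = ⊥-elim (a≢c refl)
    Loc-≢ zero    (suc c) a≤ c≤ a≢c = ⇒-intro (⇒-elim (weaken (S≢zer (below c (<⇒≤ c≤)))) (≐-sym assume))
    Loc-≢ (suc a) zero    a≤ c≤ a≢c = S≢zer (below a (<⇒≤ a≤))
    Loc-≢ (suc a) (suc c) a≤ c≤ a≢c = ⇒-intro (⇒-elim (weaken (Loc-≢ a c (<⇒≤ a≤) (<⇒≤ c≤) (a≢c ∘ cong suc)))
      (⇒-elim (weaken (S-injective (below a (<⇒≤ a≤)) (below c (<⇒≤ c≤)))) assume))

    Loc-≤ : ∀ a c → a ≤ c → c ≤ N → Γ ⊩ num a ≼ num c
    Loc-≤ zero zero    z≤n c≤ = ≼-refl (below zero c≤)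
    Loc-≤ a    (suc c) a≤  c≤ with m≤1+n⇒m≤n∨m≡1+n a≤
    ... | inj₂ refl = ≼-refl (below (suc c) c≤)
    ... | inj₁ a≤c  = ⇒-elim (≼-step (below a (≤-trans a≤c (<⇒≤ c≤))) (below c (<⇒≤ c≤))) (Loc-≤ a c a≤c (<⇒≤ c≤))

    Loc⇒R₀UpTo : R₀UpTo Γ N
    Loc⇒R₀UpTo = record
      { add   = λ a c a≤ c≤ _ → Loc-+ a c a≤ c≤
      ; mul   = Loc-*
      ; neq   = Loc-≢
      ; leq   = Loc-≤
      ; bound = Loc-bound loc below }

  record NoOverflow {m} (Γ : Formula Lap m) (j : ℕ) : Set where
    field
      +-above : ∀ a c → a ≤ j → c ≤ j → j < a + c → Γ ⊩ ¬' (num a ⊕ num c ≼ num j)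
      *-above : ∀ a c → a ≤ j → c ≤ j → j < a * c → Γ ⊩ ¬' (num a ⊗ num c ≼ num j)
      S-above : Γ ⊩ ¬' (S (num j) ≼ num j)
  open NoOverflow public

  NoOverflow-∧ : ∀ {m} {Γ A : Formula Lap m} {j} → NoOverflow Γ j → NoOverflow (Γ ∧' A) j
  NoOverflow-∧ o = record
    { +-above = λ a c p q r → weaken (+-above o a c p q r)
    ; *-above = λ a c p q r → weaken (*-above o a c p q r)
    ; S-above = weaken (S-above o) }

  NoOverflow-wk : ∀ {m} {Γ : Formula Lap m} {j} → NoOverflow Γ j → NoOverflow (wk Γ) j
  NoOverflow-wk {Γ = Γ} {j} o = record
    { +-above = λ a c p q r →
        subst (λ x → wk Γ ⊩ ¬' x) (cong₂ _≼_ (cong₂ _⊕_ (rn a) (rn c)) (rn j)) (wk-⊢ (+-above o a c p q r))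
    ; *-above = λ a c p q r →
        subst (λ x → wk Γ ⊩ ¬' x) (cong₂ _≼_ (cong₂ _⊗_ (rn a) (rn c)) (rn j)) (wk-⊢ (*-above o a c p q r))
    ; S-above = subst (λ x → wk Γ ⊩ ¬' x) (cong₂ _≼_ (rn (suc j)) (rn j)) (wk-⊢ (S-above o)) }
    where
    rn : ∀ k → renT suc (num k) ≡ num k
    rn = renT-num suc

  module Overflow {k} {Γ : Formula Lap k} {X : Term k} {j : ℕ}
                  (loc : Γ ⊩ LocX X) (below : ∀ a → a ≤ j → Γ ⊩ num a ≼ X) (j≐X : Γ ⊩ num j ≐ X) where
    open LocFacts loc

    ⊕-descend : ∀ a c {c′} → a ≤ j → c′ ≤ c → c ≤ j → Γ ⊩ num a ⊕ num c ≼ X → Γ ⊩ num a ⊕ num c′ ≼ X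
    ⊕-descend a zero    a≤ z≤n c≤ d = d
    ⊕-descend a (suc c) a≤ c′≤ c≤ d with m≤1+n⇒m≤n∨m≡1+n c′≤
    ... | inj₂ refl = d
    ... | inj₁ c′≤c = ⊕-descend a c a≤ c′≤c (<⇒≤ c≤) (∧-elim₁ (⇒-elim (⊕-overflow (below a a≤) (below c (<⇒≤ c≤))) d))

    -- descend to a ⊕ (j ∸ a), whose value is j, and which ⊕-overflow forbids to equal X
    ⊕-refute : ∀ a c → a ≤ j → c ≤ j → j < a + c → Γ ⊩ num a ⊕ num c ≼ X → Γ ⊩ ⊥'
    ⊕-refute a c a≤ c≤ j<a+c d =
      ⇒-elim (∧-elim₂ (⇒-elim (⊕-overflow (below a a≤) (below c₀ c₀≤j)) (⊕-descend a c a≤ 1+c₀≤c c≤ d)))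
             (≐-trans (Loc-+ loc below a c₀ a≤ c₀≤j) (subst (λ x → Γ ⊩ num x ≐ X) (sym a+c₀≡j) j≐X))
      where
      c₀ : ℕ
      c₀ = j ∸ a
      a+c₀≡j : a + c₀ ≡ j
      a+c₀≡j = m+[n∸m]≡n a≤
      c₀≤j : c₀ ≤ j
      c₀≤j = m∸n≤m j a
      1+c₀≤c : suc c₀ ≤ c
      1+c₀≤c = +-cancelˡ-< a c₀ c (subst (_< a + c) (sym a+c₀≡j) j<a+c)

    ⊗-refute : ∀ a c → a ≤ j → c ≤ j → j < a * c → Γ ⊩ num a ⊗ num c ≼ X → Γ ⊩ ⊥'
    ⊗-refute a zero    a≤ c≤ j<a*0 d = ⊥-elim (n≮0 (subst (j <_) (*-zeroʳ a) j<a*0))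
    ⊗-refute a (suc c) a≤ c≤ j<     d with a * c ≤? j
    ... | no a*c≰j = ⊗-refute a c a≤ (<⇒≤ c≤) (≰⇒> a*c≰j) (⇒-elim (⊗-overflow (below a a≤) (below c (<⇒≤ c≤))) d)
    ... | yes a*c≤j = ⊕-refute (a * c) a a*c≤j a≤ (subst (j <_) (trans (*-suc a c) (+-comm a (a * c))) j<)
      (≼-resp-≐ (≐-trans (⊗-S (below a a≤) (below c (<⇒≤ c≤))) (≐-cong-⊕ (Loc-* loc below a c a≤ (<⇒≤ c≤) a*c≤j) (≐-refl (num a))))
                (≐-refl X) d)

  Loc⇒NoOverflow : ∀ {k} {Γ : Formula Lap k} {X : Term k} {j : ℕ} →
                   Γ ⊩ LocX X → (∀ a → a ≤ j → Γ ⊩ num a ≼ X) → Γ ⊩ num j ≐ X → NoOverflow Γ j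
  Loc⇒NoOverflow {k} {Γ} loc below j≐X = record
    { +-above = λ a c a≤ c≤ j< → ⇒-intro (Under.⊕-refute _ a c a≤ c≤ j< (≼-resp-≐ (≐-refl _) (weaken j≐X) assume))
    ; *-above = λ a c a≤ c≤ j< → ⇒-intro (Under.⊗-refute _ a c a≤ c≤ j< (≼-resp-≐ (≐-refl _) (weaken j≐X) assume))
    ; S-above = ⇒-intro (⇒-elim (weaken (LocFacts.S-overflow loc)) (≼-resp-≐ (≐-cong-S (weaken j≐X)) (weaken j≐X) assume)) }
    where
    module Under (A : Formula Lap k) = Overflow {Γ = Γ ∧' A} (weaken loc) (λ b b≤ → weaken (below b b≤)) (weaken j≐X)

module FitsRefutation (T : Theory) where
  open Derivations T
  open BoundedCompleteness T
  open LocalArithmetic T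

  module _ {m} {Γ : Formula Lap m} {j : ℕ} (r : R₀UpTo Γ j) (o : NoOverflow Γ j) where

    refute-either : ∀ {A B : Formula Lap m} {x y} → (¬ x ≤ j → Γ ⊩ ¬' A) → (¬ y ≤ j → Γ ⊩ ¬' B) →
                    ¬ x ⊔ y ≤ j → Γ ⊩ ¬' (A ∧' B)
    refute-either {x = x} refuteA refuteB h with x ≤? j
    ... | no x≰  = ¬∧₁ (refuteA x≰)
    ... | yes x≤ = ¬∧₂ (refuteB λ y≤ → h (⊔-lub x≤ y≤))

    module _ {n k} (ρ : Fin n → Fin k) (u : Term k) (e : Fin k → ℕ) (e≤j : ∀ i → e i ≤ j) (u≐j : Γ ⊩ instT e u ≐ num j) where

      value≤j : ∀ t → peakT (e ∘ ρ) t ≤ j → evalT (e ∘ ρ) t ≤ j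
      value≤j t = ≤-trans (evalT≤peakT (e ∘ ρ) t)

      eval-renT : ∀ t → peakT (e ∘ ρ) t ≤ j → Γ ⊩ instT e (renT ρ t) ≐ num (evalT (e ∘ ρ) t)
      eval-renT t h = subst (λ x → Γ ⊩ x ≐ num (evalT (e ∘ ρ) t)) (sym (subT-renT (num ∘ e) ρ t)) (eval-term r (e ∘ ρ) t h)

      -- a term whose own value is the first to exceed j is an overflow refuted by o
      FitsT-refute : ∀ t → ¬ peakT (e ∘ ρ) t ≤ j → Γ ⊩ ¬' (inst e (FitsT ρ u t))
      FitsT-refute (var i) h = ⊥-elim (h (e≤j (ρ i)))
      FitsT-refute zer     h = ⊥-elim (h z≤n)
      FitsT-refute (S t)   h with peakT (e ∘ ρ) t ≤? j
      ... | no t≰ = ¬∧₁ (FitsT-refute t t≰)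
      ... | yes t≤ = ¬∧₂ (⇒-intro (⇒-elim (weaken (S-above o))
                      (≼-resp-≐ (≐-cong-S (weaken t≐j)) (weaken u≐j) assume)))
        where
        t≡j : evalT (e ∘ ρ) t ≡ j
        t≡j with m≤n⇒m<n∨m≡n (value≤j t t≤)
        ... | inj₁ t<j = ⊥-elim (h (⊔-lub t<j t≤))
        ... | inj₂ t≡j = t≡j
        t≐j : Γ ⊩ instT e (renT ρ t) ≐ num j
        t≐j = subst (λ v → Γ ⊩ instT e (renT ρ t) ≐ num v) t≡j (eval-renT t t≤)
      FitsT-refute (s ⊕ t) h with peakT (e ∘ ρ) s ≤? j | peakT (e ∘ ρ) t ≤? j
      ... | no s≰  | _      = ¬∧₁ (¬∧₁ (FitsT-refute s s≰))
      ... | yes _  | no t≰  = ¬∧₁ (¬∧₂ (FitsT-refute t t≰))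
      ... | yes s≤ | yes t≤ = ¬∧₂ (⇒-intro (⇒-elim
            (weaken (+-above o _ _ (value≤j s s≤) (value≤j t t≤) (≰⇒> λ ≤j → h (⊔-lub ≤j (⊔-lub s≤ t≤)))))
            (≼-resp-≐ (≐-cong-⊕ (weaken (eval-renT s s≤)) (weaken (eval-renT t t≤))) (weaken u≐j) assume)))
      FitsT-refute (s ⊗ t) h with peakT (e ∘ ρ) s ≤? j | peakT (e ∘ ρ) t ≤? j
      ... | no s≰  | _      = ¬∧₁ (¬∧₁ (FitsT-refute s s≰))
      ... | yes _  | no t≰  = ¬∧₁ (¬∧₂ (FitsT-refute t t≰))
      ... | yes s≤ | yes t≤ = ¬∧₂ (⇒-intro (⇒-elim
            (weaken (*-above o _ _ (value≤j s s≤) (value≤j t t≤) (≰⇒> λ ≤j → h (⊔-lub ≤j (⊔-lub s≤ t≤)))))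
            (≼-resp-≐ (≐-cong-⊗ (weaken (eval-renT s s≤)) (weaken (eval-renT t t≤))) (weaken u≐j) assume)))

      FitsBelow-refute : ∀ t {ψ : Formula La (suc n)} (p : Bounded ψ) →
                         (∀ y → y ≤ j → ¬ peakF p (extend y (e ∘ ρ)) ≤ j → Γ ⊩ ¬' (inst (extend y e) (Fits (liftR ρ) (wkT u) p))) →
                         ¬ peakT (e ∘ ρ) t ⊔ maxUpTo (evalT (e ∘ ρ) t) (λ a → peakF p (extend a (e ∘ ρ))) ≤ j →
                         Γ ⊩ ¬' (inst e (FitsBelow ρ u t (Fits (liftR ρ) (wkT u) p)))
      FitsBelow-refute t p inner h with peakT (e ∘ ρ) t ≤? j
      ... | no t≰ = ¬∧₁ (FitsT-refute t t≰)
      ... | yes t≤ with bounded-search (evalT (e ∘ ρ) t) (λ a → peakF p (extend a (e ∘ ρ)) ≤? j)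
      ...   | inj₁ all = ⊥-elim (h (⊔-lub t≤ (maxUpTo-lub _ _ all)))
      ...   | inj₂ (y , y≤t , y≰) = ¬∧₂ (⇒-intro (⇒-elim (weaken (inner y (≤-trans y≤t (value≤j t t≤)) y≰))
                                       (∀≤-elim-num e (renT ρ t) (Fits (liftR ρ) (wkT u) p) assume (weaken y≼t))))
        where
        y≼t : Γ ⊩ num y ≼ instT e (renT ρ t)
        y≼t = ≼-resp-≐ (≐-refl (num y)) (≐-sym (eval-renT t t≤)) (leq r y _ y≤t (value≤j t t≤))

    Fits-refute : ∀ {n k} {φ : Formula La n} (b : Bounded φ) (ρ : Fin n → Fin k) (u : Term k) (e : Fin k → ℕ) →
                  (∀ i → e i ≤ j) → Γ ⊩ instT e u ≐ num j → ¬ peakF b (e ∘ ρ) ≤ j → Γ ⊩ ¬' (inst e (Fits ρ u b))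
    Fits-refute-under : ∀ {n k} {ψ : Formula La (suc n)} (p : Bounded ψ) (ρ : Fin n → Fin k) (u : Term k) (e : Fin k → ℕ) →
                        (∀ i → e i ≤ j) → Γ ⊩ instT e u ≐ num j →
                        ∀ y → y ≤ j → ¬ peakF p (extend y (e ∘ ρ)) ≤ j → Γ ⊩ ¬' (inst (extend y e) (Fits (liftR ρ) (wkT u) p))

    Fits-refute (b≐ s t)  ρ u e e≤j u≐j = refute-either (FitsT-refute ρ u e e≤j u≐j s) (FitsT-refute ρ u e e≤j u≐j t)
    Fits-refute (b≼ s t)  ρ u e e≤j u≐j = refute-either (FitsT-refute ρ u e e≤j u≐j s) (FitsT-refute ρ u e e≤j u≐j t)
    Fits-refute b⊥        ρ u e e≤j u≐j h = ⊥-elim (h z≤n)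
    Fits-refute (b⇒ p q)  ρ u e e≤j u≐j = refute-either (Fits-refute p ρ u e e≤j u≐j) (Fits-refute q ρ u e e≤j u≐j)
    Fits-refute (b∧ p q)  ρ u e e≤j u≐j = refute-either (Fits-refute p ρ u e e≤j u≐j) (Fits-refute q ρ u e e≤j u≐j)
    Fits-refute (b∨ p q)  ρ u e e≤j u≐j = refute-either (Fits-refute p ρ u e e≤j u≐j) (Fits-refute q ρ u e e≤j u≐j)
    Fits-refute (b∀≤ t p) ρ u e e≤j u≐j = FitsBelow-refute ρ u e e≤j u≐j t p (Fits-refute-under p ρ u e e≤j u≐j)
    Fits-refute (b∃≤ t p) ρ u e e≤j u≐j = FitsBelow-refute ρ u e e≤j u≐j t p (Fits-refute-under p ρ u e e≤j u≐j)

    Fits-refute-under p ρ u e e≤j u≐j y y≤j y≰ =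
      Fits-refute p (liftR ρ) (wkT u) (extend y e) extend≤j (subst (λ x → Γ ⊩ x ≐ num j) (sym (subT-renT _ suc u)) u≐j)
                  (y≰ ∘ subst (_≤ j) (peakF-cong p (extend-liftR y e ρ)))
      where
      extend≤j : ∀ i → extend y e i ≤ j
      extend≤j zero    = y≤j
      extend≤j (suc i) = e≤j i

WitnessedBelow : ∀ {n k} {φ : Formula La n} → (Fin n → Fin k) → Term k → IsΣ₁ φ → Formula La k
WitnessedBelow ρ u (bnd {δ = δ} b) = Fits ρ u b ∧' ren ρ δ
WitnessedBelow ρ u (ex s)          = ∃' (var zero ≼ wkT u ∧' WitnessedBelow (liftR ρ) (wkT u) s)

witnessPeak : ∀ {n} {φ : Formula La n} → IsΣ₁ φ → (e : Fin n → ℕ) → Sat e φ → ℕ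
witnessPeak (bnd b) e _       = peakF b e
witnessPeak (ex s)  e (a , x) = a ⊔ witnessPeak s (extend a e) x

witnessPeak-cong : ∀ {n} {φ : Formula La n} (s : IsΣ₁ φ) {e e′ : Fin n → ℕ} (h : e ≗ e′) (x : Sat e φ) →
                   witnessPeak s e′ (Sat-cong h φ x) ≡ witnessPeak s e x
witnessPeak-cong (bnd b)          h x       = sym (peakF-cong b h)
witnessPeak-cong (ex s)          h (a , x) = cong (a ⊔_) (witnessPeak-cong s (extend-cong a h) x)

module Witnesses (T : Theory) where
  open Derivations T
  open BoundedCompleteness T
  open LocalArithmetic T
  open FitsRefutation T

  WitnessedBelow-intro : ∀ {n k m} {φ : Formula La n} (s : IsΣ₁ φ) (ρ : Fin n → Fin k) (u : Term k) (e : Fin k → ℕ)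
                         {Γ : Formula Lap m} → (∀ N → R₀UpTo Γ N) →
                         (x : Sat (e ∘ ρ) φ) → witnessPeak s (e ∘ ρ) x ≤ evalT e u → Γ ⊩ inst e (WitnessedBelow ρ u s)
  WitnessedBelow-intro (bnd {δ = δ} b) ρ u e {Γ} r x h = ∧-intro
    (proj₁ (bounded-decides (Fits-bounded ρ u b) e (r _) ≤-refl) (Fits-sat ρ u b e h))
    (subst (Γ ⊩_) (sym (inst-ren e ρ δ)) (proj₁ (bounded-decides b (e ∘ ρ) (r _) ≤-refl) x))
  WitnessedBelow-intro (ex {φ = φ} s) ρ u e r (a , x) h =
    ∃≤-intro e u (WitnessedBelow (liftR ρ) (wkT u) s) (num≼instT (r _) e u ≤-refl (m⊔n≤o⇒m≤o _ _ h))
      (WitnessedBelow-intro s (liftR ρ) (wkT u) (extend a e) r x′ h′)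
    where
    to-lifted : extend a (e ∘ ρ) ≗ extend a e ∘ liftR ρ
    to-lifted = sym ∘ extend-liftR a e ρ
    x′ : Sat (extend a e ∘ liftR ρ) φ
    x′ = Sat-cong to-lifted φ x
    h′ : witnessPeak s (extend a e ∘ liftR ρ) x′ ≤ evalT (extend a e) (wkT u)
    h′ = subst₂ _≤_ (sym (witnessPeak-cong s to-lifted x)) (sym (evalT-wkT a e u)) (m⊔n≤o⇒n≤o a _ h)

  WitnessedBelow-refute : ∀ {n k m} {φ : Formula La n} (s : IsΣ₁ φ) (ρ : Fin n → Fin k) (u : Term k) (e : Fin k → ℕ)
                          {Γ : Formula Lap m} {j} → R₀UpTo Γ j → NoOverflow Γ j → (∀ i → e i ≤ j) →
                          peakT e u ≤ j → evalT e u ≡ j → ¬ Sat (e ∘ ρ) φ → Γ ⊩ ¬' (inst e (WitnessedBelow ρ u s))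
  WitnessedBelow-refute (bnd {δ = δ} b) ρ u e {Γ} {j} r o e≤j u≤j u≡j ¬x with peakF b (e ∘ ρ) ≤? j
  ... | no b≰ = ¬∧₁ (Fits-refute r o b ρ u e e≤j (subst (λ x → Γ ⊩ instT e u ≐ num x) u≡j (eval-term r e u u≤j)) b≰)
  ... | yes b≤ = ¬∧₂ (subst (λ x → Γ ⊩ ¬' x) (sym (inst-ren e ρ δ)) (proj₂ (bounded-decides b (e ∘ ρ) r b≤) ¬x))
  WitnessedBelow-refute {k = k} {m} (ex {φ = φ} s) ρ u e {Γ} {j} r o e≤j u≤j u≡j ¬x =
    ⇒-intro (∃≤-elim e u W′ assume (below-bound rΔ e u u≤j (∧-elim₁ assume)) λ i i≤ →
      WitnessedBelow-refute s (liftR ρ) (wkT u) (extend i e) rΔ oΔ (extend≤j i≤)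
        (subst (_≤ _) (sym (peakT-ren (extend i e) suc u)) u≤j) (trans (evalT-wkT i e u) u≡j)
        (¬x ∘ (i ,_) ∘ Sat-cong (extend-liftR i e ρ) φ))
    where
    W′ : Formula La (suc k)
    W′ = WitnessedBelow (liftR ρ) (wkT u) s
    Δ : Formula Lap (suc m)
    Δ = wk (Γ ∧' inst e (∃' (var zero ≼ wkT u ∧' W′))) ∧' (var zero ≼ instᵇT e u ∧' instᵇ e W′)
    rΔ : R₀UpTo Δ j
    rΔ = R₀UpTo-∧ (R₀UpTo-wk (R₀UpTo-∧ r))
    oΔ : NoOverflow Δ j
    oΔ = NoOverflow-∧ (NoOverflow-wk (NoOverflow-∧ o))
    extend≤j : ∀ {i} → i ≤ evalT e u → ∀ x → extend i e x ≤ j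
    extend≤j i≤ zero    = ≤-trans i≤ (≤-trans (evalT≤peakT e u) u≤j)
    extend≤j i≤ (suc x) = e≤j x

P-below : Formula Lap 1
P-below = ∀' (var zero ≼ var (suc zero) ⇒ P (var zero))

Witnessed : ∀ {σ : Sentence La} → IsΣ₁ σ → Formula La 1
Witnessed s = WitnessedBelow (λ ()) (var zero) s

matrix : ∀ {σ : Sentence La} → IsΣ₁ σ → Formula Lap 1
matrix s = emb Loc ∧' P-below ∧' emb (Witnessed s)

[_]ₚ : Σ₁Sentence → Sentence Lap
[ σ , s ]ₚ = emb σ ∧' ∃' (matrix s)

⟨τ⟩⊢τ : ∀ (τ : Sentence Lap) → ⟨ τ ⟩ ⊢ τ
⟨τ⟩⊢τ τ = subst (⟨ τ ⟩ ⊢_) (closedWk-zero τ) (hyp refl)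

[σ]ₚ⊢σ : ∀ (σ : Σ₁Sentence) → ⟨ [ σ ]ₚ ⟩ ⊢ emb (proj₁ σ)
[σ]ₚ⊢σ σ = mp ax-∧₁ (⟨τ⟩⊢τ [ σ ]ₚ)

module TrueCase where
  open Derivations R₀p
  open BoundedCompleteness R₀p
  open Witnesses R₀p

  R₀p-R₀UpTo : ∀ {m} {Γ : Formula Lap m} N → R₀UpTo Γ N
  R₀p-R₀UpTo N = record
    { add   = λ a c _ _ _ → axiom (cong₂ _≐_ (cong₂ _⊕_ (renT-num _ a) (renT-num _ c)) (renT-num _ (a + c))) (r₀ (r-add a c))
    ; mul   = λ a c _ _ _ → axiom (cong₂ _≐_ (cong₂ _⊗_ (renT-num _ a) (renT-num _ c)) (renT-num _ (a * c))) (r₀ (r-mul a c))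
    ; neq   = λ a c _ _ a≢c → axiom (cong ¬' (cong₂ _≐_ (renT-num _ a) (renT-num _ c))) (r₀ (r-neq a c a≢c))
    ; leq   = λ a c a≤c _ → axiom (cong₂ _≼_ (renT-num _ a) (renT-num _ c)) (r₀ (r-leq a c a≤c))
    ; bound = λ c _ → axiom (ren-bound-axiom _ c) (r₀ (r-bnd c)) }
    where
    axiom : ∀ {m} {Γ : Formula Lap m} {σ X} → closedWk σ ≡ X → R₀p σ → Γ ⊩ X
    axiom eq ax = const (subst (R₀p ⊢_) eq (hyp ax))

  Σ₁-complete : ∀ {n m} {φ : Formula La n} (s : IsΣ₁ φ) (e : Fin n → ℕ) {Γ : Formula Lap m} → Sat e φ → Γ ⊩ inst e φ
  Σ₁-complete (bnd b)        e x       = proj₁ (bounded-decides b e (R₀p-R₀UpTo _) ≤-refl) x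
  Σ₁-complete (ex {φ = φ} s) e {Γ} (a , x) = ∃-intro (num a) (subst (Γ ⊩_) (sym (instᵇ-[num] e φ a)) (Σ₁-complete s (extend a e) x))

  P-below-num : ∀ {m} {Γ : Formula Lap m} K → Γ ⊩ sub (λ _ → num K) P-below
  P-below-num {Γ = Γ} K = ∀-intro (⇒-intro (bigOr-elim K
    (bigOr-from-bound K (bound (R₀p-R₀UpTo K) K ≤-refl)
                        (subst (λ x → wk Γ ∧' var zero ≼ wkT (num K) ⊩ var zero ≼ x) (renT-num suc K) assume))
    λ i _ → ⇒-intro (P-resp-≐ (≐-sym assume) (const (subst (R₀p ⊢_) (cong P (renT-num _ i)) (hyp (r-P i)))))))

  [σ]ₚ-provable : ∀ (σ : Σ₁Sentence) → ℕ⊨ proj₁ σ → R₀p ⊢ [ σ ]ₚ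
  [σ]ₚ-provable (σ , s) x = discharge (∧-intro σ-holds (∃-intro (num K) (subst (⊥' ⇒ ⊥' ⊩_) (sym matrix≡)
    (∧-intro (proj₁ (bounded-decides Loc-bounded e (R₀p-R₀UpTo _) ≤-refl) (Loc-true e))
             (∧-intro (P-below-num K) (WitnessedBelow-intro s (λ ()) (var zero) e R₀p-R₀UpTo x′ K-bound))))))
    where
    K : ℕ
    K = witnessPeak s (λ ()) x
    e : Fin 1 → ℕ
    e _ = K
    x′ : Sat (e ∘ λ ()) σ
    x′ = Sat-cong (λ ()) σ x
    K-bound : witnessPeak s (e ∘ λ ()) x′ ≤ K
    K-bound = subst (_≤ K) (sym (witnessPeak-cong s (λ ()) x)) ≤-refl
    σ-holds : ⊥' ⇒ ⊥' ⊩ emb σ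
    σ-holds = subst (⊥' ⇒ ⊥' ⊩_) (trans (inst-closed σ) (closedWk-zero (emb σ))) (Σ₁-complete s (λ ()) x)
    matrix≡ : matrix s [ num K ] ≡ (inst e Loc ∧' sub (λ _ → num K) P-below ∧' inst e (Witnessed s))
    matrix≡ = sub-cong (λ { zero → refl }) (matrix s)

module FalseCase (σ : Sentence La) (s : IsΣ₁ σ) (σ-false : ¬ (ℕ⊨ σ)) where
  open Derivations ⟨ [ σ , s ]ₚ ⟩
  open BoundedCompleteness ⟨ [ σ , s ]ₚ ⟩
  open LocalArithmetic ⟨ [ σ , s ]ₚ ⟩
  open Witnesses ⟨ [ σ , s ]ₚ ⟩

  W : Formula Lap 1
  W = emb (Witnessed s)

  body : Formula Lap 1
  body = matrix s

  x : Term 1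
  x = var zero

  body-Loc : body ⊩ LocX x
  body-Loc = subst (body ⊩_) (sym (trans (sub-cong {σ = λ _ → x} {σ′ = var} (λ { zero → refl }) (emb Loc)) (sub-id (emb Loc))))
                   (∧-elim₁ ⊩-refl)

  x≢numeral : ∀ j → (∀ a → a ≤ j → body ⊩ num a ≼ x) → body ∧' num j ≐ x ⊩ ⊥'
  x≢numeral j below = ⇒-elim (WitnessedBelow-refute s (λ ()) x (λ _ → j) r o (λ _ → ≤-refl) ≤-refl refl
                                (σ-false ∘ Sat-cong (λ ()) σ))
                             (≐-transport W′ W′-[x] (W′-[] (num j)) (≐-sym assume) (weaken (∧-elim₂ (∧-elim₂ ⊩-refl))))
    where
    r : R₀UpTo (body ∧' num j ≐ x) j
    r = Loc⇒R₀UpTo (weaken body-Loc) λ a a≤ → weaken (below a a≤)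
    o : NoOverflow (body ∧' num j ≐ x) j
    o = Loc⇒NoOverflow (weaken body-Loc) (λ a a≤ → weaken (below a a≤)) assume
    W′ : Formula Lap 2
    W′ = sub (λ _ → var zero) W
    W′-[] : ∀ u → W′ [ u ] ≡ sub (λ _ → u) W
    W′-[] u = trans (sub-sub _ _ W) (sub-cong (λ { zero → refl }) W)
    W′-[x] : W′ [ x ] ≡ W
    W′-[x] = trans (W′-[] x) (trans (sub-cong {σ′ = var} (λ { zero → refl }) W) (sub-id W))

  numerals-below-x : ∀ j a → a ≤ j → body ⊩ num a ≼ x
  numerals-below-x zero    zero z≤n = LocFacts.zer≼X body-Loc
  numerals-below-x (suc j) a    a≤  with m≤1+n⇒m≤n∨m≡1+n a≤
  ... | inj₁ a≤j  = numerals-below-x j a a≤j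
  ... | inj₂ refl = ∨-elim (LocFacts.≼X-cases body-Loc (numerals-below-x j j ≤-refl))
                           (⊥-elim⊩ (x≢numeral j (numerals-below-x j)))
                           assume

  body-R₀UpTo : ∀ N → R₀UpTo body N
  body-R₀UpTo N = Loc⇒R₀UpTo body-Loc (numerals-below-x N)

  body⊢R₀p : ∀ {A} → R₀p A → body ⊩ wk A
  body⊢R₀p (r₀ (r-add a c))     = subst (body ⊩_) (sym (cong₂ _≐_ (cong₂ _⊕_ (renT-num _ a) (renT-num _ c)) (renT-num _ (a + c))))
    (add (body-R₀UpTo (a + c)) a c (m≤m+n a c) (m≤n+m c a) ≤-refl)
  body⊢R₀p (r₀ (r-mul a c))     = subst (body ⊩_) (sym (cong₂ _≐_ (cong₂ _⊗_ (renT-num _ a) (renT-num _ c)) (renT-num _ (a * c))))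
    (mul (body-R₀UpTo (a ⊔ c ⊔ a * c)) a c (≤-trans (m≤m⊔n a c) (m≤m⊔n _ _)) (≤-trans (m≤n⊔m a c) (m≤m⊔n _ _)) (m≤n⊔m _ _))
  body⊢R₀p (r₀ (r-neq a c a≢c)) = subst (λ A → body ⊩ ¬' A) (sym (cong₂ _≐_ (renT-num _ a) (renT-num _ c)))
    (neq (body-R₀UpTo (a ⊔ c)) a c (m≤m⊔n a c) (m≤n⊔m a c) a≢c)
  body⊢R₀p (r₀ (r-bnd c))       = subst (body ⊩_) (sym (ren-bound-axiom suc c)) (bound (body-R₀UpTo c) c ≤-refl)
  body⊢R₀p (r₀ (r-leq a c a≤c)) = subst (body ⊩_) (sym (cong₂ _≼_ (renT-num _ a) (renT-num _ c)))
    (leq (body-R₀UpTo c) a c a≤c ≤-refl)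
  body⊢R₀p (r-P n)              = subst (λ t → body ⊩ P t) (sym (renT-num _ n))
    (⇒-elim (∀-elim (num n) (∧-elim₁ (∧-elim₂ ⊩-refl))) (numerals-below-x n n ≤-refl))

  [σ]ₚ⊢R₀p : ⟨ [ σ , s ]ₚ ⟩ ⊢all R₀p
  [σ]ₚ⊢R₀p A ax = mp (∃-R (body⊢R₀p ax)) (mp ax-∧₂ (⟨τ⟩⊢τ [ σ , s ]ₚ))

theorem5p1 : Σ (Σ₁Sentence → Sentence Lap) (λ f → (σ : Σ₁Sentence) → (⟨ f σ ⟩ ⊢ emb (proj₁ σ)) × ((ℕ⊨ proj₁ σ) → R₀p ⊢ f σ) × ((¬ (ℕ⊨ proj₁ σ)) → ⟨ f σ ⟩ ⊢all R₀p))
theorem5p1 = [_]ₚ , λ σ → [σ]ₚ⊢σ σ , TrueCase.[σ]ₚ-provable σ , FalseCase.[σ]ₚ⊢R₀p (proj₁ σ) (proj₂ σ)
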